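{- Let $n\ge 3$ be an integer. If $G$ is a graph on $2n$ vertices with at least $n^2-1$ edges that does not contain two distinct vertices of the same degree joined by a path of length three, then $G$ is isomorphic to the complete bipartite graph $K_{n-1,n+1}$. (Equivalently, $K_{n-1,n+1}$ is the unique such graph.)
   Context: Graphs are finite and simple. A path of length three joining vertices $a$ and $b$ is a path $a\,x\,y\,b$ with four distinct vertices and three edges $ax, xy, yb$. "Two vertices of the same degree joined by a path of length three" means there are distinct vertices $a,b$ with $d(a)=d(b)$ and a path of length three with endpoints $a$ and $b$. -}

module Defs where

open import Data.Bool using (Bool; true; false; _xor_)
open import Data.Nat using (ℕ; zero; suc; _+_; _<ᵇ_)
open import Data.Fin using (Fin; toℕ)
open import Data.List using (List; filter; length; allFin; concatMap; map)
open import Data.Product using (_×_; _,_; Σ; ∃)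
open import Relation.Binary.PropositionalEquality using (_≡_)
open import Relation.Nullary using (¬_)
open import Function.Bundles using (_↔_; Inverse)
open import Data.Bool.Properties using (T?)

record Graph (m : ℕ) : Set where
  field
    adj   : Fin m → Fin m → Bool
    sym   : ∀ i j → adj i j ≡ adj j i
    irrefl : ∀ i → adj i i ≡ false
open Graph public

degree : ∀ {m} → Graph m → Fin m → ℕ
degree G v = length (filter (λ u → T? (adj G v u)) (allFin _))

edgeCount : ∀ {m} → Graph m → ℕ
edgeCount {m} G =
  length (filter (λ p → T? (adj G (Data.Product.proj₁ p) (Data.Product.proj₂ p)))
    (concatMap (λ i → map (λ j → (i , j))
                 (filter (λ j → T? (toℕ i <ᵇ toℕ j)) (allFin m)))
               (allFin m)))

PathOfLength3 : ∀ {m} → Graph m → Fin m → Fin m → Set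
PathOfLength3 {m} G a b = Σ (Fin m) λ x → Σ (Fin m) λ y →
  ¬ a ≡ x × ¬ a ≡ y × ¬ a ≡ b × ¬ x ≡ y × ¬ x ≡ b × ¬ y ≡ b ×
  adj G a x ≡ true × adj G x y ≡ true × adj G y b ≡ true

HasEqualDegreeP3 : ∀ {m} → Graph m → Set
HasEqualDegreeP3 {m} G = Σ (Fin m) λ a → Σ (Fin m) λ b →
  ¬ a ≡ b × degree G a ≡ degree G b × PathOfLength3 G a b

-- graph isomorphism: a bijection of vertex sets preserving adjacency
-- (vertex sets Fin m and Fin m' may be syntactically different sizes;
-- the bijection forces m ≡ m')
_≅_ : ∀ {m m'} → Graph m → Graph m' → Set
_≅_ {m} {m'} G H = Σ (Fin m ↔ Fin m') λ f →
  ∀ i j → adj G i j ≡ adj H (Inverse.to f i) (Inverse.to f j)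

private
  side : ∀ {m} → ℕ → Fin m → Bool
  side a v = toℕ v <ᵇ a

  xor-self : ∀ b → (b xor b) ≡ false
  xor-self false = Relation.Binary.PropositionalEquality.refl
  xor-self true = Relation.Binary.PropositionalEquality.refl

  xor-comm : ∀ b c → (b xor c) ≡ (c xor b)
  xor-comm false false = Relation.Binary.PropositionalEquality.refl
  xor-comm false true = Relation.Binary.PropositionalEquality.refl
  xor-comm true false = Relation.Binary.PropositionalEquality.refl
  xor-comm true true = Relation.Binary.PropositionalEquality.refl

K : (a b : ℕ) → Graph (a + b)
K a b = record
  { adj = λ i j → side a i xor side a j
  ; sym = λ i j → xor-comm (side a i) (side a j)
  ; irrefl = λ i → xor-self (side a i)
  }

{-# OPTIONS --safe #-}
module Submission where

-- Let x have maximum degree Δ, put A = N(x), k = 2n − Δ and Δ = k + 2t, so that n = k + t.  Compare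
-- each degree with k on A and with Δ off A; since 2n² − 2kΔ − 2t² = 0 and e(G) ≥ n² − 1, the total
-- excess over k on A (gain) is at least 2t² − 2 plus the total deficiency (loss).
-- If some c in A also has degree Δ, then no edge joins N(x) − c to N(c) − x; the common neighbours
-- have distinct degrees and the private ones small degree, which is impossible.
-- Otherwise the gains are at most 2t − 1.  A vertex of A with degree above k has a neighbour in A,
-- and for an edge vw inside A the path v w x u shows that no further u in A has the degree of v.  So
-- positive gains are distinct, up to one exceptional pair, and their sum is at most about 2t² − t;
-- this leaves room only for t = 1 with all gains and losses zero, which is K_{n-1,n+1}.

open import Defs hiding (sym; irrefl)
open import Algebra.Properties.CommutativeMonoid.Sum using ()
open import Algebra.Properties.CommutativeSemigroup using ()
open import Algebra.Properties.Semiring.Sum using ()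
open import Data.Bool using (Bool; true; false; not; _∧_; _∨_; _xor_; if_then_else_)
import Data.Bool.Properties as Bool
open import Data.Bool.Properties using (T?; T-≡; ¬-not; ∧-zeroʳ; ∧-identityʳ)
open import Data.Empty using (⊥; ⊥-elim)
open import Data.Fin using (Fin; zero; suc; toℕ; join)
open import Data.Fin.Properties using (_≟_; any?; +↔⊎; toℕ-↑ˡ; toℕ-↑ʳ; toℕ<n; toℕ-injective)
open import Data.List using (List; []; _∷_; length; map; filter; concatMap; allFin)
import Data.List as List
open import Data.List.Properties using (filter-++; length-++)
open import Data.List.Relation.Unary.All as All using (All; []; _∷_)
open import Data.List.Relation.Unary.AllPairs using ([]; _∷_)
open import Data.List.Relation.Unary.Unique.Propositional using (Unique)
open import Data.Nat using (ℕ; zero; suc; _+_; _*_; _∸_; _≤_; _<_; z≤n; s≤s; s≤s⁻¹; _<ᵇ_)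
import Data.Nat as ℕ
open import Data.Nat.ListAction using () renaming (sum to listSum)
open import Data.Nat.Properties hiding (_≟_)
open import Data.Nat.Tactic.RingSolver using (solve-∀)
open import Data.Product using (Σ; ∃; _×_; _,_; proj₁; proj₂)
open import Data.Sum using (_⊎_; inj₁; inj₂; map₁; map₂)
open import Function using (_∘_; _↔_; mk↔ₛ′; Inverse; Equivalence)
open import Function.Construct.Composition using (_↔-∘_)
open import Function.Construct.Symmetry using (↔-sym)
open import Relation.Binary.PropositionalEquality
  using (_≡_; _≢_; refl; sym; trans; cong; cong₂; subst; subst₂; module ≡-Reasoning)
open import Relation.Nullary using (¬_; Dec; yes; no; does; ¬?; contradiction; _×-dec_)
open import Relation.Nullary.Decidable using (dec-true; dec-false; decidable-stable)

open Algebra.Properties.CommutativeMonoid.Sum +-0-commutativeMonoid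
  using (sum; sum-cong-≗; ∑-distrib-+; ∑-comm; sum-replicate-zero)
open Algebra.Properties.CommutativeSemigroup +-commutativeSemigroup using (x∙yz≈y∙xz)
open Algebra.Properties.Semiring.Sum +-*-semiring using (*-distribʳ-sum)

private variable
  m : ℕ

-- Sums and cardinalities over Fin m

sum-mono : {f g : Fin m → ℕ} → (∀ v → f v ≤ g v) → sum f ≤ sum g
sum-mono {zero}  f≤g = z≤n
sum-mono {suc m} f≤g = +-mono-≤ (f≤g zero) (sum-mono (f≤g ∘ suc))

sum≡0 : {f : Fin m → ℕ} → (∀ v → f v ≡ 0) → sum f ≡ 0
sum≡0 {m} f≡0 = trans (sum-cong-≗ f≡0) (sum-replicate-zero m)

sum-const : ∀ m c → sum {m} (λ _ → c) ≡ m * c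
sum-const zero    c = refl
sum-const (suc m) c = cong (c +_) (sum-const m c)

term≤sum : (f : Fin m → ℕ) → ∀ v → f v ≤ sum f
term≤sum f zero    = m≤m+n _ _
term≤sum f (suc v) = ≤-trans (term≤sum (f ∘ suc) v) (m≤n+m _ _)

sum≡0⇒≡0 : {f : Fin m → ℕ} → sum f ≤ 0 → ∀ v → f v ≡ 0
sum≡0⇒≡0 {f = f} sum≤0 v = n≤0⇒n≡0 (≤-trans (term≤sum f v) sum≤0)

erase : Fin m → (Fin m → ℕ) → Fin m → ℕ
erase v f u = if does (u ≟ v) then 0 else f u

erase-other : {v u : Fin m} (f : Fin m → ℕ) → u ≢ v → erase v f u ≡ f u
erase-other {v = v} {u} f u≢v with u ≟ v
... | yes u≡v = contradiction u≡v u≢v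
... | no _    = refl

erase≤ : (v : Fin m) (f : Fin m → ℕ) → ∀ u → erase v f u ≤ f u
erase≤ v f u with u ≟ v
... | yes _ = z≤n
... | no _  = ≤-refl

erase-positive : (v : Fin m) (f : Fin m → ℕ) → ∀ {u} → 0 < erase v f u → u ≢ v × 0 < f u
erase-positive v f {u} with u ≟ v
... | no u≢v = u≢v ,_
... | yes _  = λ ()

sum-erase : (v : Fin m) (f : Fin m → ℕ) → sum f ≡ f v + sum (erase v f)
sum-erase {suc m} zero    f = refl
sum-erase {suc m} (suc v) f = trans (cong (f zero +_)
  (trans (sum-erase v (f ∘ suc)) (cong (f (suc v) +_) (sum-cong-≗ erase-suc))))
  (x∙yz≈y∙xz (f zero) (f (suc v)) _)
  where
  erase-suc : ∀ u → erase v (f ∘ suc) u ≡ erase (suc v) f (suc u)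
  erase-suc u with u ≟ v
  ... | yes _ = refl
  ... | no _  = refl

sum-at : {v : Fin m} {f : Fin m → ℕ} → (∀ u → u ≢ v → f u ≡ 0) → sum f ≡ f v
sum-at {v = v} {f} f≡0 = trans (sum-erase v f) (trans (cong (f v +_) (sum≡0 erased)) (+-identityʳ _))
  where
  erased : ∀ u → erase v f u ≡ 0
  erased u with u ≟ v
  ... | yes _  = refl
  ... | no u≢v = f≡0 u u≢v

sum-list≤ : (f : Fin m → ℕ) {l : List (Fin m)} → Unique l → listSum (map f l) ≤ sum f
sum-list≤ f []                     = z≤n
sum-list≤ f (_∷_ {x = v} {l} v∉l uniq) = begin
  f v + listSum (map f l)           ≡⟨ cong (f v +_) (erase-list v∉l) ⟨
  f v + listSum (map (erase v f) l) ≤⟨ +-monoʳ-≤ (f v) (sum-list≤ (erase v f) uniq) ⟩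
  f v + sum (erase v f)              ≡⟨ sum-erase v f ⟨
  sum f                              ∎
  where
  open ≤-Reasoning
  erase-list : ∀ {l} → All (v ≢_) l → listSum (map (erase v f) l) ≡ listSum (map f l)
  erase-list []          = refl
  erase-list (v≢u ∷ v∉l) = cong₂ _+_ (erase-other f (v≢u ∘ sym)) (erase-list v∉l)

sumTo : (ℕ → ℕ) → ℕ → ℕ
sumTo w zero    = 0
sumTo w (suc b) = w (suc b) + sumTo w b

-- At most one vertex attains `suc b`; erasing it lowers the bound and keeps the positive values
-- distinct. The identity weight bounds a sum of gains, and `sgn` bounds the number of positive
-- values.
sum-injective : (w : ℕ → ℕ) → w 0 ≡ 0 → (f : Fin m → ℕ) →
  (∀ {u v} → 0 < f u → f u ≡ f v → u ≡ v) → ∀ b → (∀ v → f v ≤ b) →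
  sum (w ∘ f) ≤ sumTo w b
sum-injective w w0 f inj zero    f≤b = ≤-reflexive (sum≡0 (λ v → trans (cong w (n≤0⇒n≡0 (f≤b v))) w0))
sum-injective w w0 f inj (suc b) f≤b with any? (λ v → f v ℕ.≟ suc b)
... | no ∄v = ≤-trans
  (sum-injective w w0 f inj b (λ v → s≤s⁻¹ (≤∧≢⇒< (f≤b v) (λ eq → ∄v (v , eq)))))
  (m≤n+m _ _)
... | yes (v , fv≡) = begin
  sum (w ∘ f)                                  ≡⟨ sum-erase v (w ∘ f) ⟩
  w (f v) + sum (erase v (w ∘ f))              ≡⟨ cong₂ (λ a b → w a + b) fv≡ (sum-cong-≗ erase-w) ⟩
  w (suc b) + sum (w ∘ erase v f)
    ≤⟨ +-monoʳ-≤ (w (suc b)) (sum-injective w w0 (erase v f) inj′ b bound) ⟩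
  w (suc b) + sumTo w b                        ∎
  where
  open ≤-Reasoning
  erase-w : ∀ u → erase v (w ∘ f) u ≡ w (erase v f u)
  erase-w u with u ≟ v
  ... | yes _ = sym w0
  ... | no _  = refl
  inj′ : ∀ {u u′} → 0 < erase v f u → erase v f u ≡ erase v f u′ → u ≡ u′
  inj′ {u} {u′} pos eq with erase-positive v f pos
  ... | u≢v , 0<fu with u′ ≟ v
  ... | yes u′≡v = contradiction (subst (0 <_) eq pos) (<-irrefl refl)
  ... | no u′≢v  = inj 0<fu (trans (sym (erase-other f u≢v)) eq)
  bound : ∀ u → erase v f u ≤ b
  bound u with u ≟ v
  ... | yes _  = z≤n
  ... | no u≢v = s≤s⁻¹ (≤∧≢⇒< (f≤b u)
    (λ eq → u≢v (inj (subst (0 <_) (sym eq) (s≤s z≤n)) (trans eq (sym fv≡)))))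

-- Counting with Boolean predicates.

⟦_⟧ : Bool → ℕ
⟦ true ⟧  = 1
⟦ false ⟧ = 0

count : (Fin m → Bool) → ℕ
count P = sum (λ v → ⟦ P v ⟧)

infixl 6 _∖_
_∖_ : (Fin m → Bool) → Fin m → Fin m → Bool
(P ∖ v) u = P u ∧ not (does (u ≟ v))

∖-intro : {P : Fin m → Bool} {v u : Fin m} → P u ≡ true → u ≢ v → (P ∖ v) u ≡ true
∖-intro {v = v} {u} Pu u≢v rewrite Pu with u ≟ v
... | yes u≡v = contradiction u≡v u≢v
... | no _    = refl

∖-elim : {P : Fin m → Bool} {v u : Fin m} → (P ∖ v) u ≡ true → P u ≡ true × u ≢ v
∖-elim {P = P} {v} {u} eq with P u | u ≟ v
∖-elim () | false | _
∖-elim () | true  | yes _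
∖-elim eq | true  | no u≢v = refl , u≢v

count-∖ : {P : Fin m → Bool} {v : Fin m} → P v ≡ true → count P ≡ suc (count (P ∖ v))
count-∖ {P = P} {v} Pv = trans (sum-erase v (λ u → ⟦ P u ⟧))
  (cong₂ _+_ (cong ⟦_⟧ Pv) (sum-cong-≗ erase-∖))
  where
  erase-∖ : ∀ u → erase v (λ u → ⟦ P u ⟧) u ≡ ⟦ (P ∖ v) u ⟧
  erase-∖ u with u ≟ v
  ... | yes _ = cong ⟦_⟧ (sym (∧-zeroʳ (P u)))
  ... | no _  = cong ⟦_⟧ (sym (∧-identityʳ (P u)))

count-∨ : (P Q : Fin m → Bool) → count (λ v → P v ∨ Q v) ≤ count P + count Q
count-∨ P Q = ≤-trans (sum-mono (λ v → ⟦a∨b⟧≤ (P v) (Q v)))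
  (≤-reflexive (∑-distrib-+ (⟦_⟧ ∘ P) (⟦_⟧ ∘ Q)))
  where
  ⟦a∨b⟧≤ : ∀ a b → ⟦ a ∨ b ⟧ ≤ ⟦ a ⟧ + ⟦ b ⟧
  ⟦a∨b⟧≤ true  b = s≤s z≤n
  ⟦a∨b⟧≤ false b = ≤-refl

count-not : (P : Fin m → Bool) → count P + count (not ∘ P) ≡ m
count-not {m} P = trans (sym (∑-distrib-+ (⟦_⟧ ∘ P) (⟦_⟧ ∘ not ∘ P)))
  (trans (sum-cong-≗ (λ v → ⟦b⟧+⟦not-b⟧ (P v))) (trans (sum-const m 1) (*-identityʳ m)))
  where
  ⟦b⟧+⟦not-b⟧ : ∀ b → ⟦ b ⟧ + ⟦ not b ⟧ ≡ 1
  ⟦b⟧+⟦not-b⟧ true  = refl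
  ⟦b⟧+⟦not-b⟧ false = refl

listed : List (Fin m) → Fin m → ℕ
listed []      u = 0
listed (v ∷ l) u = ⟦ does (u ≟ v) ⟧ + listed l u

sum-listed : (l : List (Fin m)) → sum (listed l) ≡ length l
sum-listed {m} []      = sum-replicate-zero m
sum-listed {m} (v ∷ l) = trans (∑-distrib-+ (λ u → ⟦ does (u ≟ v) ⟧) (listed l))
  (cong₂ _+_ (trans (sum-at elsewhere) (cong ⟦_⟧ (dec-true (v ≟ v) refl))) (sum-listed l))
  where
  elsewhere : ∀ u → u ≢ v → ⟦ does (u ≟ v) ⟧ ≡ 0
  elsewhere u u≢v = cong ⟦_⟧ (dec-false (u ≟ v) u≢v)

listed≡0 : {v : Fin m} (l : List (Fin m)) → listed l v ≡ 0 → All (v ≢_) l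
listed≡0 []      _  = []
listed≡0 {v = v} (u ∷ l) eq with v ≟ u
... | no v≢u = v≢u ∷ listed≡0 l eq

-- Pigeonhole: otherwise `P` would be covered by `Q` and the entries of `l`. Most vertices needed
-- for paths are found this way.
pick : (P Q : Fin m → Bool) (l : List (Fin m)) → count Q + length l < count P →
  ∃ λ v → P v ≡ true × Q v ≡ false × All (v ≢_) l
pick P Q l small
  with any? (λ v → (P v Bool.≟ true) ×-dec (Q v Bool.≟ false) ×-dec All.all? (λ u → ¬? (v ≟ u)) l)
... | yes found = found
... | no ∄v = contradiction small (≤⇒≯ (begin
  count P                              ≤⟨ sum-mono covered ⟩
  sum (λ v → ⟦ Q v ⟧ + listed l v)     ≡⟨ ∑-distrib-+ (⟦_⟧ ∘ Q) (listed l) ⟩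
  count Q + sum (listed l)             ≡⟨ cong (count Q +_) (sum-listed l) ⟩
  count Q + length l                   ∎))
  where
  open ≤-Reasoning
  covered : ∀ v → ⟦ P v ⟧ ≤ ⟦ Q v ⟧ + listed l v
  covered v with P v in Pv | Q v in Qv | listed l v in lv
  ... | false | _     | _     = z≤n
  ... | true  | true  | _     = s≤s z≤n
  ... | true  | false | suc _ = s≤s z≤n
  ... | true  | false | zero  = contradiction (v , Pv , Qv , listed≡0 l lv) ∄v

pickOff : (P : Fin m → Bool) (l : List (Fin m)) → length l < count P →
  ∃ λ v → P v ≡ true × All (v ≢_) l
pickOff {m} P l small with pick P (λ _ → false) l
  (subst (λ c → c + length l < count P) (sym (sum-replicate-zero m)) small)
... | v , Pv , _ , v∉l = v , Pv , v∉l

-- Each vertex contributes at most one to the indicators of `P`, `Q` and their common complement,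
-- and the complement contains `l`.
count-disjoint : (P Q : Fin m → Bool) {l : List (Fin m)} →
  (∀ {v} → P v ≡ true → Q v ≡ true → ⊥) → Unique l →
  All (λ v → P v ≡ false × Q v ≡ false) l →
  count P + (count Q + length l) ≤ m
count-disjoint {m} P Q {l} P∩Q=∅ uniq outside = begin
  count P + (count Q + length l)
    ≡⟨ cong (λ s → count P + (count Q + s)) (count-outside outside) ⟨
  count P + (count Q + listSum (map (⟦_⟧ ∘ neither) l))
    ≤⟨ +-monoʳ-≤ (count P) (+-monoʳ-≤ (count Q) (sum-list≤ (⟦_⟧ ∘ neither) uniq)) ⟩
  count P + (count Q + count neither)
    ≡⟨ cong (count P +_) (∑-distrib-+ (⟦_⟧ ∘ Q) (⟦_⟧ ∘ neither)) ⟨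
  count P + sum (λ v → ⟦ Q v ⟧ + ⟦ neither v ⟧)
    ≡⟨ ∑-distrib-+ (⟦_⟧ ∘ P) (λ v → ⟦ Q v ⟧ + ⟦ neither v ⟧) ⟨
  sum (λ v → ⟦ P v ⟧ + (⟦ Q v ⟧ + ⟦ neither v ⟧))
    ≤⟨ sum-mono at-most-one ⟩
  sum {m} (λ _ → 1)
    ≡⟨ trans (sum-const m 1) (*-identityʳ m) ⟩
  m ∎
  where
  open ≤-Reasoning
  neither : Fin m → Bool
  neither v = not (P v) ∧ not (Q v)
  count-outside : ∀ {l} → All (λ v → P v ≡ false × Q v ≡ false) l →
    listSum (map (⟦_⟧ ∘ neither) l) ≡ length l
  count-outside []                       = refl
  count-outside {v ∷ l} ((Pv , Qv) ∷ vs) rewrite Pv | Qv = cong suc (count-outside vs)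
  at-most-one : ∀ v → ⟦ P v ⟧ + (⟦ Q v ⟧ + ⟦ neither v ⟧) ≤ 1
  at-most-one v with P v in Pv | Q v in Qv
  ... | true  | true  = ⊥-elim (P∩Q=∅ Pv Qv)
  ... | true  | false = ≤-refl
  ... | false | true  = ≤-refl
  ... | false | false = ≤-refl

argmax : (f : Fin m → ℕ) → Fin m → ∃ λ x → ∀ v → f v ≤ f x
argmax {suc zero}    f _ = zero , λ { zero → ≤-refl }
argmax {suc (suc m)} f _ with argmax (f ∘ suc) zero
... | x , f≤fx with ≤-total (f zero) (f (suc x))
... | inj₁ f0≤ = suc x , λ { zero → f0≤ ; (suc v) → f≤fx v }
... | inj₂ ≤f0 = zero  , λ { zero → ≤-refl ; (suc v) → ≤-trans (f≤fx v) ≤f0 }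

-- The degree sum

length-filter-tabulate : {A : Set} (p : A → Bool) (f : Fin m → A) →
  length (filter (T? ∘ p) (List.tabulate f)) ≡ count (p ∘ f)
length-filter-tabulate {zero}  p f = refl
length-filter-tabulate {suc m} p f with p (f zero)
... | true  = cong suc (length-filter-tabulate p (f ∘ suc))
... | false = length-filter-tabulate p (f ∘ suc)

degree≡count : (G : Graph m) → ∀ v → degree G v ≡ count (adj G v)
degree≡count G v = length-filter-tabulate (adj G v) (λ u → u)

edgeCount≡ : (G : Graph m) →
  edgeCount G ≡ sum (λ i → count (λ j → (toℕ i <ᵇ toℕ j) ∧ adj G i j))
edgeCount≡ {m} G = length-filter-concatMap (λ i → i)
  where
  p : Fin m × Fin m → Bool
  p (i , j) = adj G i j
  row : Fin m → List (Fin m × Fin m)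
  row i = map (i ,_) (filter (λ j → T? (toℕ i <ᵇ toℕ j)) (allFin m))
  -- `g` is arbitrary because `allFin` is a `tabulate`: the induction composes it with `suc` at each
  -- step.
  length-row : ∀ i {k} (g : Fin k → Fin m) →
    length (filter (T? ∘ p) (map (i ,_) (filter (λ j → T? (toℕ i <ᵇ toℕ j)) (List.tabulate g))))
    ≡ count (λ j → (toℕ i <ᵇ toℕ (g j)) ∧ adj G i (g j))
  length-row i {zero}  g = refl
  length-row i {suc k} g with toℕ i <ᵇ toℕ (g zero)
  ... | false = length-row i (g ∘ suc)
  ... | true with adj G i (g zero)
  ... | true  = cong suc (length-row i (g ∘ suc))
  ... | false = length-row i (g ∘ suc)
  length-filter-concatMap : ∀ {k} (f : Fin k → Fin m) →
    length (filter (T? ∘ p) (concatMap row (List.tabulate f)))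
    ≡ sum (λ i → count (λ j → (toℕ (f i) <ᵇ toℕ j) ∧ adj G (f i) j))
  length-filter-concatMap {zero}  f = refl
  length-filter-concatMap {suc k} f = trans
    (cong length (filter-++ (T? ∘ p) (row (f zero)) (concatMap row (List.tabulate (f ∘ suc)))))
    (trans (length-++ (filter (T? ∘ p) (row (f zero))))
      (cong₂ _+_ (length-row (f zero) (λ j → j)) (length-filter-concatMap (f ∘ suc))))

-- Adjacency splits by the order of the two ends into the indicators `e i j` and `e j i`; exchanging
-- the sums makes both totals the edge count.
handshake : (G : Graph m) → sum (degree G) ≡ edgeCount G + edgeCount G
handshake {m} G = begin-equality
  sum (degree G)                                  ≡⟨ sum-cong-≗ (degree≡count G) ⟩
  sum (λ i → sum (λ j → ⟦ adj G i j ⟧))           ≡⟨ sum-cong-≗ (λ i → sum-cong-≗ (split i)) ⟩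
  sum (λ i → sum (λ j → e i j + e j i))           ≡⟨ sum-cong-≗ (λ i → ∑-distrib-+ (e i) (λ j → e j i)) ⟩
  sum (λ i → sum (e i) + sum (λ j → e j i))       ≡⟨ ∑-distrib-+ (λ i → sum (e i)) (λ i → sum (λ j → e j i)) ⟩
  sum (λ i → sum (e i)) + sum (λ i → sum (λ j → e j i))
    ≡⟨ cong₂ _+_ (sym (edgeCount≡ G)) (trans (∑-comm (λ i j → e j i)) (sym (edgeCount≡ G))) ⟩
  edgeCount G + edgeCount G                       ∎
  where
  open ≤-Reasoning
  e : Fin m → Fin m → ℕ
  e i j = ⟦ (toℕ i <ᵇ toℕ j) ∧ adj G i j ⟧
  order : ∀ a b → a ≢ b → ((a <ᵇ b) ≡ true × (b <ᵇ a) ≡ false) ⊎ ((a <ᵇ b) ≡ false × (b <ᵇ a) ≡ true)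
  order zero    zero    a≢b = contradiction refl a≢b
  order zero    (suc b) _   = inj₁ (refl , refl)
  order (suc a) zero    _   = inj₂ (refl , refl)
  order (suc a) (suc b) a≢b = order a b (a≢b ∘ cong suc)
  split : ∀ i j → ⟦ adj G i j ⟧ ≡ e i j + e j i
  split i j with i ≟ j
  ... | yes refl rewrite Graph.irrefl G i | ∧-zeroʳ (toℕ i <ᵇ toℕ i) = refl
  ... | no i≢j with order (toℕ i) (toℕ j) (i≢j ∘ toℕ-injective)
  ... | inj₁ (eq , eq′) rewrite eq | eq′ = sym (+-identityʳ _)
  ... | inj₂ (eq , eq′) rewrite eq | eq′ = cong ⟦_⟧ (Graph.sym G i j)

-- Complete bipartite graphs

isLeft : {A B : Set} → A ⊎ B → Bool
isLeft (inj₁ _) = true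
isLeft (inj₂ _) = false

partition : (P : Fin m → Bool) →
  Σ (Fin m ↔ (Fin (count P) ⊎ Fin (count (not ∘ P)))) λ f → ∀ v → isLeft (Inverse.to f v) ≡ P v
partition {zero}  P = mk↔ₛ′ (λ ()) (λ { (inj₁ ()) ; (inj₂ ()) }) (λ { (inj₁ ()) ; (inj₂ ()) }) (λ ()) , λ ()
partition {suc m} P with P zero in P0 | partition (P ∘ suc)
... | true | f , side = mk↔ₛ′ to′ from′ to-from from-to , side′
  where
  open Inverse f
  to′ : Fin (suc m) → Fin (suc (count (P ∘ suc))) ⊎ Fin (count (not ∘ P ∘ suc))
  to′ zero    = inj₁ zero
  to′ (suc v) = map₁ suc (to v)
  from′ : Fin (suc (count (P ∘ suc))) ⊎ Fin (count (not ∘ P ∘ suc)) → Fin (suc m)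
  from′ (inj₁ zero)    = zero
  from′ (inj₁ (suc i)) = suc (from (inj₁ i))
  from′ (inj₂ j)       = suc (from (inj₂ j))
  to-from : ∀ s → to′ (from′ s) ≡ s
  to-from (inj₁ zero)    = refl
  to-from (inj₁ (suc i)) = cong (map₁ suc) (strictlyInverseˡ (inj₁ i))
  to-from (inj₂ j)       = cong (map₁ suc) (strictlyInverseˡ (inj₂ j))
  from-to : ∀ v → from′ (to′ v) ≡ v
  from-to zero    = refl
  from-to (suc v) with to v in eq
  ... | inj₁ i = cong suc (trans (cong from (sym eq)) (strictlyInverseʳ v))
  ... | inj₂ j = cong suc (trans (cong from (sym eq)) (strictlyInverseʳ v))
  side′ : ∀ v → isLeft (to′ v) ≡ P v
  side′ zero    = sym P0
  side′ (suc v) with to v | side v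
  ... | inj₁ _ | eq = eq
  ... | inj₂ _ | eq = eq
... | false | f , side = mk↔ₛ′ to′ from′ to-from from-to , side′
  where
  open Inverse f
  to′ : Fin (suc m) → Fin (count (P ∘ suc)) ⊎ Fin (suc (count (not ∘ P ∘ suc)))
  to′ zero    = inj₂ zero
  to′ (suc v) = map₂ suc (to v)
  from′ : Fin (count (P ∘ suc)) ⊎ Fin (suc (count (not ∘ P ∘ suc))) → Fin (suc m)
  from′ (inj₁ i)       = suc (from (inj₁ i))
  from′ (inj₂ zero)    = zero
  from′ (inj₂ (suc j)) = suc (from (inj₂ j))
  to-from : ∀ s → to′ (from′ s) ≡ s
  to-from (inj₁ i)       = cong (map₂ suc) (strictlyInverseˡ (inj₁ i))
  to-from (inj₂ zero)    = refl
  to-from (inj₂ (suc j)) = cong (map₂ suc) (strictlyInverseˡ (inj₂ j))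
  from-to : ∀ v → from′ (to′ v) ≡ v
  from-to zero    = refl
  from-to (suc v) with to v in eq
  ... | inj₁ i = cong suc (trans (cong from (sym eq)) (strictlyInverseʳ v))
  ... | inj₂ j = cong suc (trans (cong from (sym eq)) (strictlyInverseʳ v))
  side′ : ∀ v → isLeft (to′ v) ≡ P v
  side′ zero    = sym P0
  side′ (suc v) with to v | side v
  ... | inj₁ _ | eq = eq
  ... | inj₂ _ | eq = eq

-- The left summand of `Fin (a + b)` consists of the values below `a`, which is how `K` tells its
-- two sides apart.
join-side : ∀ a b (s : Fin a ⊎ Fin b) → (toℕ (join a b s) <ᵇ a) ≡ isLeft s
join-side a b (inj₁ i) rewrite toℕ-↑ˡ i b = Equivalence.to T-≡ (<⇒<ᵇ (toℕ<n i))
join-side a b (inj₂ j) rewrite toℕ-↑ʳ a j =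
  ¬-not (λ eq → ≤⇒≯ (m≤m+n a (toℕ j)) (<ᵇ⇒< (a + toℕ j) a (Equivalence.from T-≡ eq)))

complete-bipartite : (G : Graph m) (P : Fin m → Bool) →
  (∀ u v → adj G u v ≡ P u xor P v) → G ≅ K (count P) (count (not ∘ P))
complete-bipartite G P adj≡ with partition P
... | f , side = (↔-sym +↔⊎) ↔-∘ f , λ u v →
  trans (adj≡ u v) (sym (cong₂ _xor_ (side-K u) (side-K v)))
  where
  side-K : ∀ v → (toℕ (join (count P) (count (not ∘ P)) (Inverse.to f v)) <ᵇ count P) ≡ P v
  side-K v = trans (join-side _ _ (Inverse.to f v)) (side v)

-- Graphs without a path of length three between vertices of equal degree

-- Leaves all rearranging to the ring solver: the two equations bring a common part `c` to the front
-- of both sides, where it cancels. The estimates thus stay free of subtraction.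
cancel-≤ : ∀ c {l r a b} → l ≤ r → l ≡ c + a → r ≡ c + b → a ≤ b
cancel-≤ c l≤r refl refl = +-cancelˡ-≤ c _ _ l≤r

true≢false : ∀ {b} → b ≡ true → b ≡ false → ⊥
true≢false refl ()

-- Both sides are the maximum of `m` and `n`.
m+[n∸m]≡n+[m∸n] : ∀ m n → m + (n ∸ m) ≡ n + (m ∸ n)
m+[n∸m]≡n+[m∸n] zero    zero    = refl
m+[n∸m]≡n+[m∸n] zero    (suc n) = cong suc (sym (+-identityʳ n))
m+[n∸m]≡n+[m∸n] (suc m) zero    = cong suc (+-identityʳ m)
m+[n∸m]≡n+[m∸n] (suc m) (suc n) = cong suc (m+[n∸m]≡n+[m∸n] m n)

positive : ℕ → Bool
positive zero    = false
positive (suc _) = true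

sgn : ℕ → ℕ
sgn n = ⟦ positive n ⟧

sumTo-sgn : ∀ b → sumTo sgn b ≡ b
sumTo-sgn zero    = refl
sumTo-sgn (suc b) = cong suc (sumTo-sgn b)

sumTo-id : ∀ s → sumTo (λ j → j) (s + s) ≡ s * (s + s) + s
sumTo-id zero    = refl
sumTo-id (suc s) rewrite +-suc s s | sumTo-id s = polynomial s
  where
  polynomial : ∀ s → suc (suc (s + s)) + (suc (s + s) + (s * (s + s) + s))
    ≡ suc (suc (s + s) + s * suc (suc (s + s)) + suc s)
  polynomial = solve-∀

-- At least two of the three numbers are 0. The trailing 0 matches `listSum` of a three-element
-- list.
two-equal : ∀ a b c → a + (b + (c + 0)) ≤ 1 → a ≡ b ⊎ a ≡ c ⊎ b ≡ c
two-equal zero    zero    _       _        = inj₁ refl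
two-equal zero    (suc b) zero    _        = inj₂ (inj₁ refl)
two-equal zero    (suc b) (suc c) (s≤s le) = contradiction (m+n≤o⇒n≤o b le) λ ()
two-equal (suc a) zero    zero    _        = inj₂ (inj₂ refl)
two-equal (suc a) zero    (suc c) (s≤s le) = contradiction (m+n≤o⇒n≤o a le) λ ()
two-equal (suc a) (suc b) _       (s≤s le) = contradiction (m+n≤o⇒n≤o a le) λ ()

-- In the application m = 2n and n = k + t.
module Extremal {m} (G : Graph m) (no3 : ¬ HasEqualDegreeP3 G) (x : Fin m) (k t : ℕ)
  (m≡ : m ≡ k + degree G x)
  (maximal : ∀ v → degree G v ≤ degree G x)
  (dx≡ : degree G x ≡ k + (t + t))
  (3≤k+t : 3 ≤ k + t)
  (dense : (k + t) * (k + t) * 2 ≤ sum (degree G) + 2)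
  where

  -- The degree balance and disjoint neighbourhoods.

  d : Fin m → ℕ
  d = degree G

  infix 4 _∼_ _≁_
  _∼_ _≁_ : Fin m → Fin m → Set
  u ∼ v = adj G u v ≡ true
  u ≁ v = adj G u v ≡ false

  d≡ : ∀ v → d v ≡ count (adj G v)
  d≡ = degree≡count G

  ∼-sym : ∀ {u v} → u ∼ v → v ∼ u
  ∼-sym {u} {v} u∼v = trans (Graph.sym G v u) u∼v

  ≁-sym : ∀ {u v} → u ≁ v → v ≁ u
  ≁-sym {u} {v} u≁v = trans (Graph.sym G v u) u≁v

  ∼⇒≢ : ∀ {u v} → u ∼ v → u ≢ v
  ∼⇒≢ {u} u∼u refl = true≢false u∼u (Graph.irrefl G u)

  ∼≁⇒≢ : ∀ {u v w} → u ∼ v → u ≁ w → v ≢ w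
  ∼≁⇒≢ u∼v u≁v refl = true≢false u∼v u≁v

  -- The path is a u w b; the three distinctness conditions not listed follow from its edges.
  no-path : ∀ {a u w b} → a ∼ u → u ∼ w → w ∼ b → a ≢ b → a ≢ w → u ≢ b → d a ≢ d b
  no-path {a} {u} {w} {b} au uw wb a≢b a≢w u≢b da≡db =
    no3 (a , b , a≢b , da≡db , u , w , ∼⇒≢ au , a≢w , a≢b , ∼⇒≢ uw , u≢b , ∼⇒≢ wb , au , uw , wb)

  Δ≥3 : 3 ≤ d x
  Δ≥3 = ≤-trans 3≤k+t (≤-trans (+-monoʳ-≤ k (m≤m+n t t)) (≤-reflexive (sym dx≡)))

  outside : Fin m → Bool
  outside v = not (adj G x v)

  count-outside : count outside ≡ k
  count-outside = +-cancelˡ-≡ (d x) _ _ (trans (cong (_+ count outside) (d≡ x))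
    (trans (count-not (adj G x)) (trans m≡ (+-comm k (d x)))))

  gain loss : Fin m → ℕ
  gain v = if adj G x v then d v ∸ k else 0
  loss v = if adj G x v then k ∸ d v else (d x ∸ d v)

  gain-in : ∀ {v} → x ∼ v → gain v ≡ d v ∸ k
  gain-in x∼v rewrite x∼v = refl

  loss-in : ∀ {v} → x ∼ v → loss v ≡ k ∸ d v
  loss-in x∼v rewrite x∼v = refl

  loss-out : ∀ {v} → x ≁ v → loss v ≡ d x ∸ d v
  loss-out x≁v rewrite x≁v = refl

  gain-pos : ∀ {v} → 0 < gain v → x ∼ v × d v ≡ k + gain v
  gain-pos {v} pos with adj G x v
  ... | true = refl , sym (m+[n∸m]≡n {k} (<⇒≤ (m∸n≢0⇒n<m (>⇒≢ pos))))

  gain≡0⇒≤k : ∀ {v} → x ∼ v → gain v ≡ 0 → d v ≤ k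
  gain≡0⇒≤k x∼v g≡0 = m∸n≡0⇒m≤n (trans (sym (gain-in x∼v)) g≡0)

  -- The reference degrees, k on A and Δ = k + 2t off A, sum to 2k² + 4kt, which is 2t² less than
  -- 2(k + t)².
  balance : t * t * 2 + sum loss ≤ sum gain + 2
  balance = cancel-≤ (k * k * 2 + k * t * 4) (+-monoˡ-≤ (sum loss) dense)
    (lhs k t (sum loss))
    (trans (swap (sum d) (sum loss)) (trans (cong (_+ 2) total) (rhs k t (sum gain))))
    where
    lhs : ∀ k t l → (k + t) * (k + t) * 2 + l ≡ k * k * 2 + k * t * 4 + (t * t * 2 + l)
    lhs = solve-∀
    rhs : ∀ k t g → (k + (k + (t + t))) * k + k * (t + t) + g + 2 ≡ k * k * 2 + k * t * 4 + (g + 2)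
    rhs = solve-∀
    swap : ∀ a b → a + 2 + b ≡ a + b + 2
    swap = solve-∀
    pointwise : ∀ v → d v + loss v ≡ k + ⟦ outside v ⟧ * (t + t) + gain v
    pointwise v with adj G x v
    ... | true  = trans (m+[n∸m]≡n+[m∸n] (d v) k) (cong (_+ (d v ∸ k)) (sym (+-identityʳ k)))
    ... | false = trans (m+[n∸m]≡n (maximal v)) (trans dx≡ (trim k (t + t)))
      where
      trim : ∀ k s → k + s ≡ k + (s + 0) + 0
      trim = solve-∀
    total : sum d + sum loss ≡ (k + (k + (t + t))) * k + k * (t + t) + sum gain
    total = trans (sym (∑-distrib-+ d loss)) (trans (sum-cong-≗ pointwise)
      (trans (∑-distrib-+ (λ v → k + ⟦ outside v ⟧ * (t + t)) gain)
      (cong (_+ sum gain) (trans (∑-distrib-+ (λ _ → k) (λ v → ⟦ outside v ⟧ * (t + t)))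
      (cong₂ _+_ (trans (sum-const m k) (cong (_* k) (trans m≡ (cong (k +_) dx≡))))
        (trans (sym (*-distribʳ-sum (t + t) (⟦_⟧ ∘ outside))) (cong (_* (t + t)) count-outside)))))))

  -- N(v), N(b) - a and `l` are pairwise disjoint sets of vertices, the second of size Δ - 1, and
  -- there are k + Δ vertices in all.
  avoid : ∀ {v a b} {l : List (Fin m)} → b ∼ a → d b ≡ d x →
    (∀ {w} → v ∼ w → b ∼ w → w ≢ a → ⊥) → Unique l → All (λ u → v ≁ u × b ≁ u) l →
    d v + length l ≤ suc k
  avoid {v} {a} {b} {l} b∼a db≡ disjoint uniq outs = cancel-≤ c
    (count-disjoint (adj G v) (adj G b ∖ a) apart uniq (widen outs))
    (trans (cong (_+ (c + length l)) (sym (d≡ v))) (swap (d v) c (length l)))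
    (trans m≡ (trans (cong (k +_) (trans (sym db≡) (trans (d≡ b) (count-∖ {P = adj G b} b∼a)))) (shift k c)))
    where
    c = count (adj G b ∖ a)
    swap : ∀ a b c → a + (b + c) ≡ b + (a + c)
    swap = solve-∀
    shift : ∀ a b → a + suc b ≡ b + suc a
    shift = solve-∀
    apart : ∀ {w} → v ∼ w → (adj G b ∖ a) w ≡ true → ⊥
    apart v∼w w∈ with b∼w , w≢a ← ∖-elim {P = adj G b} w∈ = disjoint v∼w b∼w w≢a
    widen : ∀ {l} → All (λ u → v ≁ u × b ≁ u) l → All (λ u → v ≁ u × (adj G b ∖ a) u ≡ false) l
    widen []                   = []
    widen ((v≁u , b≁u) ∷ outs) = (v≁u , cong (_∧ _) b≁u) ∷ widen outs

  -- A common neighbour w of `u` and `b` other than `a` would give the path a u w b. So `avoid`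
  -- applies, and `b` and `u` themselves lie in neither N(u) nor N(b).
  private-neighbour-low : ∀ {a b u} → a ∼ b → d a ≡ d x → d b ≡ d x →
    a ∼ u → u ≢ b → b ≁ u → d u < k
  private-neighbour-low {a} {b} {u} a∼b da db a∼u u≢b b≁u =
    s≤s⁻¹ (subst (_≤ suc k) (+-comm (d u) 2)
      (avoid (∼-sym a∼b) db
        (λ u∼w b∼w w≢a → no-path a∼u u∼w (∼-sym b∼w) (∼⇒≢ a∼b) (w≢a ∘ sym) u≢b (trans da (sym db)))
        ((u≢b ∘ sym ∷ []) ∷ [] ∷ [])
        ((≁-sym b≁u , Graph.irrefl G b) ∷ (Graph.irrefl G u , b≁u) ∷ [])))

  -- Two adjacent vertices of maximum degree.

  module AdjacentMaxima {c} (x∼c : x ∼ c) (dc≡ : d c ≡ d x) where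

    c∼x : c ∼ x
    c∼x = ∼-sym x∼c

    -- The path u x c v makes the Δ - 1 common neighbours of `x` and `c` have distinct degrees, and
    -- the path x y c v keeps these below Δ. Only the Δ - 2 values from 2 to Δ - 1 remain.
    module Twins (twins : ∀ u → x ∼ u → u ≢ c → c ∼ u) where

      M : Fin m → Bool
      M = adj G x ∖ c

      -- Shifted by one so that the possible values are 1 to Δ - 2, with 0 reserved for vertices off
      -- `M`.
      f : Fin m → ℕ
      f v = if M v then d v ∸ 1 else 0

      d≥2 : ∀ {v} → x ∼ v → v ≢ c → 2 ≤ d v
      d≥2 {v} x∼v v≢c = subst (2 ≤_) (sym (d≡ v))
        (subst (_≤ count (adj G v))
          (cong₂ (λ a b → ⟦ a ⟧ + (⟦ b ⟧ + 0)) (∼-sym x∼v) (∼-sym (twins v x∼v v≢c)))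
          (sum-list≤ (λ u → ⟦ adj G v u ⟧) {x ∷ c ∷ []} ((∼⇒≢ x∼c ∷ []) ∷ [] ∷ [])))

      d≢Δ : ∀ {v} → x ∼ v → v ≢ c → d v ≢ d x
      d≢Δ {v} x∼v v≢c dv≡ with pickOff (adj G x) (c ∷ v ∷ []) (subst (3 ≤_) (d≡ x) Δ≥3)
      ... | y , x∼y , y≢c ∷ y≢v ∷ [] =
        no-path x∼y (∼-sym (twins y x∼y y≢c)) (twins v x∼v v≢c) (∼⇒≢ x∼v) (∼⇒≢ x∼c) y≢v (sym dv≡)

      f-pos : ∀ {v} → 0 < f v → x ∼ v × v ≢ c
      f-pos {v} pos with M v in Mv
      ... | true = ∖-elim {P = adj G x} Mv

      f-in : ∀ {v} → x ∼ v → v ≢ c → f v ≡ d v ∸ 1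
      f-in x∼v v≢c rewrite ∖-intro {P = adj G x} x∼v v≢c = refl

      f-injective : ∀ {u v} → 0 < f u → f u ≡ f v → u ≡ v
      f-injective {u} {v} pos fu≡fv with u ≟ v
      ... | yes u≡v = u≡v
      ... | no u≢v with x∼u , u≢c ← f-pos pos | x∼v , v≢c ← f-pos (subst (0 <_) fu≡fv pos) =
        ⊥-elim (no-path (∼-sym x∼u) x∼c (twins v x∼v v≢c) u≢v u≢c (∼⇒≢ x∼v)
          (∸-cancelʳ-≡ (<⇒≤ (d≥2 x∼u u≢c)) (<⇒≤ (d≥2 x∼v v≢c))
            (trans (sym (f-in x∼u u≢c)) (trans fu≡fv (f-in x∼v v≢c)))))

      f-bound : ∀ v → f v ≤ d x ∸ 2
      f-bound v with M v in Mv
      ... | false = z≤n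
      ... | true with x∼v , v≢c ← ∖-elim {P = adj G x} Mv =
        ∸-monoˡ-≤ 2 (≤∧≢⇒< (maximal v) (d≢Δ x∼v v≢c))

      sgn-f : ∀ v → ⟦ M v ⟧ ≡ sgn (f v)
      sgn-f v with M v in Mv
      ... | false = refl
      ... | true with x∼v , v≢c ← ∖-elim {P = adj G x} Mv | d v | d≥2 x∼v v≢c
      ... | suc (suc _) | _ = refl
      ... | suc zero | s≤s ()

      impossible : ⊥
      impossible = <-irrefl refl (≤-trans (s≤s (begin
        count M              ≡⟨ sum-cong-≗ sgn-f ⟩
        sum (sgn ∘ f)        ≤⟨ sum-injective sgn refl f f-injective (d x ∸ 2) f-bound ⟩
        sumTo sgn (d x ∸ 2)  ≡⟨ sumTo-sgn _ ⟩
        d x ∸ 2              ≡⟨ cong (_∸ 2) Δ≡ ⟩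
        count M ∸ 1          ∎)) (≤-reflexive (m+[n∸m]≡n {1} (<⇒≤ (s≤s⁻¹ (subst (3 ≤_) Δ≡ Δ≥3))))))
        where
        open ≤-Reasoning
        Δ≡ : d x ≡ suc (count M)
        Δ≡ = trans (d≡ x) (count-∖ {P = adj G x} x∼c)

    -- The private neighbour u, together with one of c, costs so much that t = 0 and all other vertices
    -- have degree Δ; a common neighbour y and a further neighbour z of u then give the path y x u z.
    module Private {u} (x∼u : x ∼ u) (u≢c : u ≢ c) (c≁u : c ≁ u) where

      -- The path x y w c makes N(y) disjoint from N(c) - x, and the path x u y c excludes `u` from
      -- N(y). Listing `u` lowers the bound from k + 1 to k.
      common-neighbour-degree : ∀ {y} → x ∼ y → c ∼ y → d y ≤ k
      common-neighbour-degree {y} x∼y c∼y = s≤s⁻¹ (subst (_≤ suc k) (+-comm (d y) 1)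
        (avoid c∼x dc≡
          (λ y∼w c∼w w≢x → no-path x∼y y∼w (∼-sym c∼w) (∼⇒≢ x∼c) (w≢x ∘ sym) (∼⇒≢ (∼-sym c∼y)) (sym dc≡))
          ([] ∷ []) ((y≁u , c≁u) ∷ [])))
        where
        y≁u : y ≁ u
        y≁u = ¬-not (λ y∼u → no-path x∼u (∼-sym y∼u) (∼-sym c∼y) (∼⇒≢ x∼c) (∼⇒≢ x∼y) u≢c (sym dc≡))

      -- N(x) and N(c) have equal size. Dropping `c` and `u` from N(x) leaves Δ - 2 vertices, so
      -- together with `x` they cannot cover the Δ neighbours of `c`.
      other-private : ∃ λ u′ → c ∼ u′ × u′ ≢ x × x ≁ u′
      other-private with pick (adj G c) (adj G x ∖ c ∖ u) (x ∷ []) (≤-reflexive (sym (begin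
          count (adj G c)                         ≡⟨ trans (sym (d≡ c)) (trans dc≡ (d≡ x)) ⟩
          count (adj G x)                         ≡⟨ count-∖ {P = adj G x} x∼c ⟩
          suc (count (adj G x ∖ c))
            ≡⟨ cong suc (count-∖ {P = adj G x ∖ c} (∖-intro {P = adj G x} x∼u u≢c)) ⟩
          suc (suc (count (adj G x ∖ c ∖ u)))     ≡⟨ cong suc (+-comm 1 _) ⟩
          suc (count (adj G x ∖ c ∖ u) + 1)       ∎)))
        where open ≡-Reasoning
      ... | v , c∼v , v∉ , v≢x ∷ [] = v , c∼v , v≢x , ¬-not (λ x∼v → true≢false
        (∖-intro {P = adj G x ∖ c} (∖-intro {P = adj G x} x∼v (∼⇒≢ (∼-sym c∼v))) (∼≁⇒≢ c∼v c≁u)) v∉)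

      private-low : ∀ {v} → x ∼ v → v ≢ c → c ≁ v → d v < k
      private-low = private-neighbour-low x∼c refl dc≡

      gain-elsewhere : ∀ v → v ≢ c → gain v ≡ 0
      gain-elsewhere v v≢c with adj G x v in x∼v | adj G c v in c∼v
      ... | false | _     = refl
      ... | true  | true  = m≤n⇒m∸n≡0 (common-neighbour-degree x∼v c∼v)
      ... | true  | false = m≤n⇒m∸n≡0 (<⇒≤ (private-low x∼v v≢c c∼v))

      sum-gain : sum gain ≡ t + t
      sum-gain = trans (sum-at gain-elsewhere) (trans (gain-in x∼c)
        (trans (cong (_∸ k) (trans dc≡ dx≡)) (m+n∸m≡n k (t + t))))

      impossible : ⊥
      impossible with u′ , c∼u′ , u′≢x , x≁u′ ← other-private =
        no-path (∼-sym x∼y) x∼u u∼z (∼≁⇒≢ x∼y x≁z) (∼≁⇒≢ c∼y c≁u) (z≢x ∘ sym) (trans dy≡ (sym dz≡))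
        where
        du<k : d u < k
        du<k = private-low x∼u u≢c c≁u

        u≢u′ : u ≢ u′
        u≢u′ = ∼≁⇒≢ x∼u x≁u′

        loss-u : 1 ≤ loss u
        loss-u = subst (1 ≤_) (sym (loss-in x∼u)) (m<n⇒0<n∸m du<k)

        loss-u′ : suc (t + t) ≤ loss u′
        loss-u′ = subst (suc (t + t) ≤_) (sym (loss-out x≁u′)) (m+n≤o⇒m≤o∸n (suc (t + t))
          (begin
            suc (t + t) + d u′ ≡⟨ +-suc (t + t) (d u′) ⟨
            t + t + suc (d u′) ≤⟨ +-monoʳ-≤ (t + t) (private-neighbour-low c∼x dc≡ refl c∼u′ u′≢x x≁u′) ⟩
            t + t + k          ≡⟨ trans (+-comm (t + t) k) (sym dx≡) ⟩
            d x                ∎))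
          where open ≤-Reasoning

        t≡0 : t ≡ 0
        -- With losses of at least 1 at `u` and 2t + 1 at `u′`, the balance gives 2t² + 2t + 2 ≤ 2t
        -- + 2.
        t≡0 = t*t*2≤0⇒t≡0 t (cancel-≤ (t + t + 2)
          (≤-trans (+-monoʳ-≤ (t * t * 2) (≤-trans (+-mono-≤ loss-u (+-monoˡ-≤ 0 loss-u′))
            (sum-list≤ loss ((u≢u′ ∷ []) ∷ [] ∷ []))))
            (≤-trans balance (≤-reflexive (cong (_+ 2) sum-gain))))
          (lhs t) (sym (+-identityʳ _)))
          where
          lhs : ∀ t → t * t * 2 + (1 + (suc (t + t) + 0)) ≡ t + t + 2 + t * t * 2
          lhs = solve-∀
          t*t*2≤0⇒t≡0 : ∀ t → t * t * 2 ≤ 0 → t ≡ 0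
          t*t*2≤0⇒t≡0 zero _ = refl

        Δ≡k : d x ≡ k
        Δ≡k = trans dx≡ (trans (cong (λ t → k + (t + t)) t≡0) (+-identityʳ k))

        sum-loss≤2 : sum loss ≤ 2
        sum-loss≤2 = ≤-trans (m≤n+m _ (t * t * 2)) (≤-trans balance
          (≤-reflexive (cong (_+ 2) (trans sum-gain (cong (λ t → t + t) t≡0)))))

        loss-u′≥1 : 1 ≤ loss u′
        loss-u′≥1 = ≤-trans (s≤s z≤n) loss-u′

        full-degree : ∀ {v} → v ≢ u → v ≢ u′ → d v ≡ k
        full-degree {v} v≢u v≢u′ = ≤-antisym (subst (d v ≤_) Δ≡k (maximal v)) k≤dv
          where
          -- `u` and `u′` already use up the total loss of 2.
          loss≡0 : loss v ≡ 0
          loss≡0 = n≤0⇒n≡0 (cancel-≤ 2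
            (≤-trans (+-mono-≤ loss-u (+-monoˡ-≤ (loss v + 0) loss-u′≥1))
              (≤-trans (sum-list≤ loss ((u≢u′ ∷ v≢u ∘ sym ∷ []) ∷ (v≢u′ ∘ sym ∷ []) ∷ [] ∷ [])) sum-loss≤2))
            (cong (2 +_) (+-identityʳ _)) refl)
          k≤dv : k ≤ d v
          k≤dv with adj G x v in x∼v
          ... | true  = m∸n≡0⇒m≤n (trans (sym (loss-in x∼v)) loss≡0)
          ... | false = subst (_≤ d v) Δ≡k (m∸n≡0⇒m≤n (trans (sym (loss-out x∼v)) loss≡0))

        y-choice : ∃ λ y → x ∼ y × All (y ≢_) (c ∷ u ∷ [])
        y-choice = pickOff (adj G x) (c ∷ u ∷ []) (subst (3 ≤_) (d≡ x) Δ≥3)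

        y = proj₁ y-choice

        x∼y : x ∼ y
        x∼y = proj₁ (proj₂ y-choice)

        dy≡ : d y ≡ k
        dy≡ = full-degree (All.head (All.tail (proj₂ (proj₂ y-choice)))) (∼≁⇒≢ x∼y x≁u′)

        c∼y : c ∼ y
        c∼y =
          ¬-not (λ c≁y → <-irrefl dy≡ (private-low x∼y (All.head (proj₂ (proj₂ y-choice))) c≁y))

        -- `u′` carries one unit of loss, so `u` loses at most one and has degree at least k - 1,
        -- which is at least 2.
        z-choice : ∃ λ z → u ∼ z × All (z ≢_) (x ∷ [])
        z-choice = pickOff (adj G u) (x ∷ []) (subst (2 ≤_) (d≡ u)
          (+-cancelʳ-≤ 1 _ _ (≤-trans (≤-trans Δ≥3 (≤-reflexive Δ≡k)) k≤du+1)))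
          where
          k≤du+1 : k ≤ d u + 1
          k≤du+1 = ≤-trans (m≤n+m∸n k (d u)) (+-monoʳ-≤ (d u) (subst (_≤ 1) (loss-in x∼u) (+-cancelʳ-≤ 1 _ _
            (≤-trans (+-monoʳ-≤ (loss u) (+-monoˡ-≤ 0 loss-u′≥1))
              (≤-trans (sum-list≤ loss ((u≢u′ ∷ []) ∷ [] ∷ [])) sum-loss≤2)))))

        z = proj₁ z-choice

        u∼z : u ∼ z
        u∼z = proj₁ (proj₂ z-choice)

        z≢x : z ≢ x
        z≢x = All.head (proj₂ (proj₂ z-choice))

        c≁z : c ≁ z
        c≁z = ¬-not (λ c∼z → no-path x∼u u∼z (∼-sym c∼z) (∼⇒≢ x∼c) (z≢x ∘ sym) u≢c (sym dc≡))

        dz≡ : d z ≡ k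
        dz≡ = full-degree (∼⇒≢ u∼z ∘ sym) (∼≁⇒≢ c∼u′ c≁z ∘ sym)

        x≁z : x ≁ z
        x≁z = ¬-not (λ x∼z → <-irrefl dz≡ (private-low x∼z (∼≁⇒≢ u∼z (≁-sym c≁u)) c≁z))

  -- Only k vertices lie off A, so the excess neighbours lie in A.
  inner : ∀ {v} (l : List (Fin m)) → k + length l < d v → ∃ λ w → v ∼ w × x ∼ w × All (w ≢_) l
  inner {v} l k+l<dv
    with pick (adj G v) outside l (subst₂ (λ a b → a + length l < b) (sym count-outside) (d≡ v) k+l<dv)
  ... | w , v∼w , inside , w∉l = w , v∼w , ¬-not (λ x≁w → true≢false (cong not x≁w) inside) , w∉l

  outside-true : ∀ {v} → x ≁ v → outside v ≡ true
  outside-true = cong not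

  outside-elim : ∀ {v} → outside v ≡ true → x ≁ v
  outside-elim {v} eq = ¬-not (λ x∼v → true≢false eq (cong not x∼v))

  outside-false : ∀ {v} → outside v ≡ false → x ∼ v
  outside-false {v} eq = ¬-not (λ x≁v → true≢false (outside-true x≁v) eq)

  k≥1 : 1 ≤ k
  k≥1 = subst₂ _≤_ (cong ⟦_⟧ (outside-true (Graph.irrefl G x))) count-outside (term≤sum (⟦_⟧ ∘ outside) x)

  k≡1+ : ∀ {b} → x ≁ b → k ≡ suc (count (outside ∖ b))
  k≡1+ x≁b = trans (sym count-outside) (count-∖ {P = outside} (outside-true x≁b))

  -- All degrees on A below the maximum.

  module InnerBelow (below : ∀ {v} → x ∼ v → d v ≢ d x) where

    -- With t = 0 one has k = Δ, so each of the at least three vertices of A loses at least one and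
    -- none gains; the balance allows a total loss of only 2.
    t≢0 : t ≢ 0
    t≢0 t≡0 = <⇒≱ Δ≥3 (begin
      d x             ≡⟨ d≡ x ⟩
      count (adj G x) ≤⟨ sum-mono inside-loss ⟩
      sum loss        ≤⟨ m≤n+m (sum loss) (t * t * 2) ⟩
      t * t * 2 + sum loss ≤⟨ balance ⟩
      sum gain + 2    ≡⟨ cong (_+ 2) (sum≡0 no-gain) ⟩
      2               ∎)
      where
      open ≤-Reasoning
      d<k : ∀ {v} → x ∼ v → d v < k
      d<k {v} x∼v = subst (d v <_) (trans dx≡ (trans (cong (λ t → k + (t + t)) t≡0) (+-identityʳ k)))
        (≤∧≢⇒< (maximal v) (below x∼v))
      inside-loss : ∀ v → ⟦ adj G x v ⟧ ≤ loss v
      inside-loss v with adj G x v in x∼v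
      ... | true  = m<n⇒0<n∸m (d<k x∼v)
      ... | false = z≤n
      no-gain : ∀ v → gain v ≡ 0
      no-gain v with adj G x v in x∼v
      ... | true  = m≤n⇒m∸n≡0 (<⇒≤ (d<k x∼v))
      ... | false = refl

    module Positive {s} (t≡1+s : t ≡ suc s) where

      -- The largest possible gain, 2t - 1, since degree Δ = k + 2t is excluded on A.
      top : ℕ
      top = suc (s + s)

      Δ≡ : d x ≡ suc (k + top)
      Δ≡ = trans dx≡ (trans (cong (λ t → k + (t + t)) t≡1+s) (shape k s))
        where
        shape : ∀ k s → k + (suc s + suc s) ≡ suc (k + suc (s + s))
        shape = solve-∀

      -- Writing t as s + 1 turns 2t² - 2 into 2s² + 4s without truncated subtraction.
      balance′ : s * s * 2 + s * 4 + sum loss ≤ sum gain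
      balance′ = cancel-≤ 2 (subst (λ t → t * t * 2 + sum loss ≤ sum gain + 2) t≡1+s balance)
        (shape s (sum loss)) (+-comm (sum gain) 2)
        where
        shape : ∀ s l → suc s * suc s * 2 + l ≡ 2 + (s * s * 2 + s * 4 + l)
        shape = solve-∀

      d≤ : ∀ {v} → x ∼ v → d v ≤ k + top
      d≤ {v} x∼v = s≤s⁻¹ (subst (d v <_) Δ≡ (≤∧≢⇒< (maximal v) (below x∼v)))

      gain≤top : ∀ v → gain v ≤ top
      gain≤top v with adj G x v in x∼v
      ... | true  = m≤n+o⇒m∸n≤o (d v) k (d≤ x∼v)
      ... | false = z≤n

      gain≤s+s : (∀ v → gain v ≢ top) → ∀ v → gain v ≤ s + s
      gain≤s+s no-top v = s≤s⁻¹ (≤∧≢⇒< (gain≤top v) (no-top v))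

      s≡0⇒k≥2 : s ≡ 0 → 2 ≤ k
      s≡0⇒k≥2 s≡0 = +-cancelʳ-≤ 1 2 k (subst (λ t → 3 ≤ k + t) (trans t≡1+s (cong suc s≡0)) 3≤k+t)

      other-outside : 2 ≤ k → ∃ λ b → x ≁ b × b ≢ x
      other-outside k≥2 with pickOff outside (x ∷ []) (subst (2 ≤_) (sym count-outside) k≥2)
      ... | b , b-out , b≢x ∷ [] = b , outside-elim b-out , b≢x

      -- The path is w v x z. An end of an edge inside A can share its degree, within A, only with
      -- the other end.
      separated : ∀ {v w z} → v ∼ w → x ∼ v → x ∼ w → x ∼ z → w ≢ z → v ≢ z → d w ≢ d z
      separated v∼w x∼v x∼w x∼z w≢z v≢z =
        no-path (∼-sym v∼w) (∼-sym x∼v) x∼z w≢z (∼⇒≢ (∼-sym x∼w)) v≢z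

      gain≡⇒d≡ : ∀ {u v} → 0 < gain u → gain u ≡ gain v → d u ≡ d v
      gain≡⇒d≡ pos eq = trans (proj₂ (gain-pos pos))
        (trans (cong (k +_) eq) (sym (proj₂ (gain-pos (subst (0 <_) eq pos)))))

      -- Pairwise distinct positive gains.

      module Distinct (gain-injective : ∀ {u v} → 0 < gain u → gain u ≡ gain v → u ≡ v) where

        sum-gain≤ : ∀ b → (∀ v → gain v ≤ b) → sum gain ≤ sumTo (λ j → j) b
        sum-gain≤ = sum-injective (λ j → j) refl gain gain-injective

        module NoTop (no-top : ∀ v → gain v ≢ top) where

          -- Distinct gains of at most 2s total at most 2s² + s, which falls 3s short of the 2s² +
          -- 4s in the balance.
          3s+loss≤0 : s * 3 + sum loss ≤ 0
          3s+loss≤0 = cancel-≤ (s * s * 2 + s) (≤-trans balance′ (sum-gain≤ (s + s) (gain≤s+s no-top)))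
            (lhs s (sum loss)) (trans (sumTo-id s) (rhs s))
            where
            lhs : ∀ s l → s * s * 2 + s * 4 + l ≡ s * s * 2 + s + (s * 3 + l)
            lhs = solve-∀
            rhs : ∀ s → s * (s + s) + s ≡ s * s * 2 + s + 0
            rhs = solve-∀

          s≡0 : s ≡ 0
          s≡0 = m*n≡0⇒m≡0 s 3 (n≤0⇒n≡0 (m+n≤o⇒m≤o (s * 3) 3s+loss≤0))

          no-loss : ∀ v → loss v ≡ 0
          no-loss = sum≡0⇒≡0 (m+n≤o⇒n≤o (s * 3) 3s+loss≤0)

          inside-degree : ∀ {v} → x ∼ v → d v ≡ k
          inside-degree {v} x∼v = ≤-antisym
            (gain≡0⇒≤k x∼v (n≤0⇒n≡0 (subst (λ s → gain v ≤ s + s) s≡0 (gain≤s+s no-top v))))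
            (m∸n≡0⇒m≤n (trans (sym (loss-in x∼v)) (no-loss v)))

          outside-degree : ∀ {v} → x ≁ v → d v ≡ d x
          outside-degree {v} x≁v = ≤-antisym (maximal v) (m∸n≡0⇒m≤n (trans (sym (loss-out x≁v)) (no-loss v)))

          -- Every vertex of A has degree k, so an edge inside A together with a third vertex of A
          -- contradicts `separated`.
          inside-independent : ∀ {u v} → x ∼ u → x ∼ v → u ≁ v
          inside-independent {u} {v} x∼u x∼v with pickOff (adj G x) (u ∷ v ∷ []) (subst (3 ≤_) (d≡ x) Δ≥3)
          ... | w , x∼w , w≢u ∷ w≢v ∷ [] = ¬-not (λ u∼v →
            separated (∼-sym u∼v) x∼v x∼u x∼w (w≢u ∘ sym) (w≢v ∘ sym)
              (trans (inside-degree x∼u) (sym (inside-degree x∼w))))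

          -- The k neighbours of `a` all lie off A, where there are just k vertices.
          complete : ∀ {a b} → x ∼ a → x ≁ b → a ∼ b
          complete {a} {b} x∼a x≁b with pick (adj G a) (outside ∖ b) []
            (≤-reflexive (trans (cong suc (+-identityʳ _))
              (trans (sym (k≡1+ x≁b)) (trans (sym (inside-degree x∼a)) (d≡ a)))))
          ... | w , a∼w , w∉ , [] = subst (a ∼_) (decidable-stable (w ≟ b) λ w≢b →
            true≢false a∼w (inside-independent x∼a
              (outside-false (¬-not λ w-out → true≢false (∖-intro {P = outside} w-out w≢b) w∉)))) a∼w

          -- `b` has degree Δ = |A| and is adjacent to all of A, which leaves no room for `b′`.
          outside-independent : ∀ {b b′} → x ≁ b → x ≁ b′ → b ≁ b′
          outside-independent {b} {b′} x≁b x≁b′ = ¬-not λ b∼b′ → impossible b∼b′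
            where
            impossible : b ∼ b′ → ⊥
            impossible b∼b′ with pick (adj G x) (adj G b ∖ b′) []
              (≤-reflexive (trans (cong suc (+-identityʳ _)) (trans (sym (count-∖ {P = adj G b} b∼b′))
                (trans (sym (d≡ b)) (trans (outside-degree x≁b) (d≡ x))))))
            ... | a , x∼a , a∉ , [] =
              true≢false (∖-intro {P = adj G b} (∼-sym (complete x∼a x≁b)) (∼≁⇒≢ x∼a x≁b′)) a∉

          bipartite : ∀ u v → adj G u v ≡ outside u xor outside v
          bipartite u v with adj G x u in x∼u | adj G x v in x∼v
          ... | true  | true  = inside-independent x∼u x∼v
          ... | true  | false = complete x∼u x∼v
          ... | false | true  = ∼-sym (complete x∼v x∼u)
          ... | false | false = outside-independent x∼u x∼v

        -- A vertex of gain 2t − 1 needs so many neighbours in A that one of them, w, has gain 0; no other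
        -- vertex of A has the degree of w, so some loss is positive.  Then t = 1, and since v misses the
        -- maximum-degree vertices outside A, it has a second neighbour in A, which costs too much.
        module Top {v} (gain-v : gain v ≡ top) where

          v-pos : 0 < gain v
          v-pos = subst (0 <_) (sym gain-v) (s≤s z≤n)

          x∼v : x ∼ v
          x∼v = proj₁ (gain-pos v-pos)

          dv≡ : d v ≡ k + top
          dv≡ = trans (proj₂ (gain-pos v-pos)) (cong (k +_) gain-v)

          -- The gains 1 to 2s + 1 total 2s² + 3s + 1, against a requirement of 2s² + 4s plus the
          -- loss.
          s+loss≤1 : s + sum loss ≤ 1
          s+loss≤1 = cancel-≤ (s * s * 2 + s * 3) (≤-trans balance′ (sum-gain≤ top gain≤top))
            (lhs s (sum loss)) (trans (cong (top +_) (sumTo-id s)) (rhs s))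
            where
            lhs : ∀ s l → s * s * 2 + s * 4 + l ≡ s * s * 2 + s * 3 + (s + l)
            lhs = solve-∀
            rhs : ∀ s → suc (s + s) + (s * (s + s) + s) ≡ s * s * 2 + s * 3 + 1
            rhs = solve-∀

          gaining : Fin m → Bool
          gaining = positive ∘ gain

          count-gaining : count gaining ≤ top
          count-gaining = ≤-trans (sum-injective sgn refl gain gain-injective top gain≤top)
            (≤-reflexive (sumTo-sgn top))

          gaining-false : ∀ {z} → gaining z ≡ false → gain z ≡ 0
          gaining-false {z} eq with zero ← gain z = refl

          -- `v` has k + `top` neighbours, while the vertices off A and the gaining vertices other
          -- than `v` number at most k + `top` - 1.
          w-choice : ∃ λ w → v ∼ w × (outside w ∨ (gaining ∖ v) w) ≡ false × All (w ≢_) []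
          w-choice = pick (adj G v) (λ z → outside z ∨ (gaining ∖ v) z) [] (begin-strict
            count (λ z → outside z ∨ (gaining ∖ v) z) + 0   ≡⟨ +-identityʳ _ ⟩
            count (λ z → outside z ∨ (gaining ∖ v) z)       ≤⟨ count-∨ outside (gaining ∖ v) ⟩
            count outside + count (gaining ∖ v)             ≡⟨ cong (_+ count (gaining ∖ v)) count-outside ⟩
            k + count (gaining ∖ v)                         <⟨ +-monoʳ-< k (≤-trans (≤-reflexive (sym
                (count-∖ {P = gaining} (gaining-v)))) count-gaining) ⟩
            k + top                                         ≡⟨ trans (sym dv≡) (d≡ v) ⟩
            count (adj G v)                                 ∎)
            where
            open ≤-Reasoning
            gaining-v : gaining v ≡ true
            gaining-v rewrite gain-v = refl

          -- Gain 0 means degree at most k, and there the truncated difference from k determines the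
          -- degree.
          distinct-loss : ∀ {z z′} → x ∼ z → x ∼ z′ → gain z ≡ 0 → gain z′ ≡ 0 → d z ≢ d z′ → loss z ≢ loss z′
          distinct-loss x∼z x∼z′ g≡0 g′≡0 d≢ l≡ = d≢ (∸-cancelˡ-≡ (gain≡0⇒≤k x∼z g≡0) (gain≡0⇒≤k x∼z′ g′≡0)
            (trans (sym (loss-in x∼z)) (trans l≡ (loss-in x∼z′))))

          ≢v : ∀ {z} → gain z ≡ 0 → v ≢ z
          ≢v g≡0 refl = <-irrefl (sym g≡0) v-pos

          -- |A| = k + `top` + 1 exceeds `top` + 1, a bound for the gaining vertices together with
          -- `w`.
          u-choice : ∀ w → ∃ λ u → x ∼ u × gaining u ≡ false × All (u ≢_) (w ∷ [])
          u-choice w = pick (adj G x) gaining (w ∷ []) (begin-strict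
            count gaining + 1  ≤⟨ +-monoˡ-≤ 1 count-gaining ⟩
            top + 1            ≡⟨ +-comm top 1 ⟩
            1 + top            ≤⟨ +-monoˡ-≤ top k≥1 ⟩
            k + top            <⟨ n<1+n _ ⟩
            suc (k + top)      ≡⟨ trans (sym Δ≡) (d≡ x) ⟩
            count (adj G x)    ∎)
            where open ≤-Reasoning

          module Losing {w u} (v∼w : v ∼ w) (x∼w : x ∼ w) (gain-w : gain w ≡ 0)
            (x∼u : x ∼ u) (gain-u : gain u ≡ 0) (w≢u : w ≢ u) where

            loss-w+u : 1 ≤ loss w + loss u
            loss-w+u = n≢0⇒n>0 λ eq → distinct-loss x∼w x∼u gain-w gain-u
              (separated v∼w x∼v x∼w x∼u w≢u (≢v gain-u))
              (trans (m+n≡0⇒m≡0 (loss w) eq) (sym (m+n≡0⇒n≡0 (loss w) eq)))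

            sum-loss≤1 : sum loss ≤ 1
            sum-loss≤1 = m+n≤o⇒n≤o s s+loss≤1

            s≡0 : s ≡ 0
            s≡0 = n≤0⇒n≡0 (+-cancelʳ-≤ 1 s 0 (≤-trans (+-monoʳ-≤ s (≤-trans loss-w+u
              (≤-trans (≤-reflexive (cong (loss w +_) (sym (+-identityʳ _))))
                (sum-list≤ loss ((w≢u ∷ []) ∷ [] ∷ []))))) s+loss≤1))

            top≡1 : top ≡ 1
            top≡1 = cong (λ s → suc (s + s)) s≡0

            k+top≡ : k + top ≡ suc k
            k+top≡ = trans (cong (k +_) top≡1) (+-comm k 1)

            gain-elsewhere : ∀ {z} → v ≢ z → gain z ≡ 0
            gain-elsewhere {z} v≢z with gain z in gz | gain≤top z
            ... | zero  | _ = refl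
            ... | suc g | le = ⊥-elim (v≢z (gain-injective v-pos (trans gain-v (trans top≡1
              (trans (≤-antisym (s≤s z≤n) (subst (suc g ≤_) top≡1 le)) (sym gz))))))

            impossible : ∃ (λ b → x ≁ b × b ≢ x) → ⊥
            impossible (b , x≁b , b≢x) = finish w′-choice
              where
              -- `w` and `u` take up the only unit of loss.
              loss-b : loss b ≡ 0
              loss-b = n≤0⇒n≡0 (+-cancelˡ-≤ 1 _ _ (≤-trans (+-monoˡ-≤ (loss b) loss-w+u)
                (≤-trans (≤-reflexive (shape (loss w) (loss u) (loss b))) (≤-trans (sum-list≤ loss
                  ((w≢u ∷ ∼≁⇒≢ x∼w x≁b ∷ []) ∷ (∼≁⇒≢ x∼u x≁b ∷ []) ∷ [] ∷ [])) sum-loss≤1))))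
                where
                shape : ∀ a b c → a + b + c ≡ a + (b + (c + 0))
                shape = solve-∀

              v≁b : v ≁ b
              v≁b = ¬-not λ v∼b → no-path x∼w (∼-sym v∼w) v∼b (b≢x ∘ sym) (∼⇒≢ x∼v) (∼≁⇒≢ x∼w x≁b)
                (≤-antisym (m∸n≡0⇒m≤n (trans (sym (loss-out x≁b)) loss-b)) (maximal b))

              -- `v` has k + 1 neighbours, at most k - 1 of them off A because it misses `b`, so one
              -- besides `w` lies in A.
              w′-choice : ∃ λ w′ → v ∼ w′ × (outside ∖ b) w′ ≡ false × All (w′ ≢_) (w ∷ [])
              w′-choice = pick (adj G v) (outside ∖ b) (w ∷ [])
                (≤-reflexive (trans (cong suc (trans (+-comm _ 1) (sym (k≡1+ x≁b))))
                  (trans (sym (trans dv≡ k+top≡)) (d≡ v))))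

              u′-choice : ∀ w′ → ∃ λ u′ → x ∼ u′ × All (u′ ≢_) (v ∷ w ∷ w′ ∷ [])
              u′-choice w′ = pickOff (adj G x) (v ∷ w ∷ w′ ∷ [])
                (subst (4 ≤_) (trans (sym (trans Δ≡ (cong suc k+top≡))) (d≡ x)) (s≤s (s≤s (s≡0⇒k≥2 s≡0))))

              finish : ∃ (λ w′ → v ∼ w′ × (outside ∖ b) w′ ≡ false × All (w′ ≢_) (w ∷ [])) → ⊥
              finish (w′ , v∼w′ , w′∉ , w′≢w ∷ []) = three-losses (u′-choice w′)
                where
                x∼w′ : x ∼ w′
                x∼w′ = outside-false (¬-not λ w′-out →
                  true≢false (∖-intro {P = outside} w′-out (∼≁⇒≢ v∼w′ v≁b)) w′∉)
                gain-w′ : gain w′ ≡ 0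
                gain-w′ = gain-elsewhere (∼⇒≢ v∼w′)
                -- The edges v w and v w′ make the three losses pairwise different, yet their sum is
                -- at most 1.
                three-losses : ∃ (λ u′ → x ∼ u′ × All (u′ ≢_) (v ∷ w ∷ w′ ∷ [])) → ⊥
                three-losses (u′ , x∼u′ , u′≢v ∷ u′≢w ∷ u′≢w′ ∷ []) = contradiction-from
                  (two-equal (loss w) (loss w′) (loss u′) (≤-trans (sum-list≤ loss
                    ((w′≢w ∘ sym ∷ u′≢w ∘ sym ∷ []) ∷ (u′≢w′ ∘ sym ∷ []) ∷ [] ∷ [])) sum-loss≤1))
                  where
                  gain-u′ : gain u′ ≡ 0
                  gain-u′ = gain-elsewhere (u′≢v ∘ sym)
                  contradiction-from : loss w ≡ loss w′ ⊎ loss w ≡ loss u′ ⊎ loss w′ ≡ loss u′ → ⊥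
                  contradiction-from (inj₁ eq) = distinct-loss x∼w x∼w′ gain-w gain-w′
                    (separated v∼w x∼v x∼w x∼w′ (w′≢w ∘ sym) (∼⇒≢ v∼w′)) eq
                  contradiction-from (inj₂ (inj₁ eq)) = distinct-loss x∼w x∼u′ gain-w gain-u′
                    (separated v∼w x∼v x∼w x∼u′ (u′≢w ∘ sym) (u′≢v ∘ sym)) eq
                  contradiction-from (inj₂ (inj₂ eq)) = distinct-loss x∼w′ x∼u′ gain-w′ gain-u′
                    (separated v∼w′ x∼v x∼w′ x∼u′ (u′≢w′ ∘ sym) (u′≢v ∘ sym)) eq

          impossible : ⊥
          impossible = from-w w-choice
            where
            from-w : ∃ (λ w → v ∼ w × (outside w ∨ (gaining ∖ v) w) ≡ false × All (w ≢_) []) → ⊥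
            from-w (w , v∼w , w∉ , []) = from-u (u-choice w)
              where
              from-u : ∃ (λ u → x ∼ u × gaining u ≡ false × All (u ≢_) (w ∷ [])) → ⊥
              from-u (u , x∼u , gu , u≢w ∷ []) = impossible′ (other-outside (s≡0⇒k≥2 s≡0))
                where
                open Losing v∼w (outside-false (Bool.∨-conicalˡ _ _ w∉))
                  (gaining-false (¬-not (λ eq → true≢false (∖-intro {P = gaining} eq (∼⇒≢ (∼-sym v∼w)))
                    (Bool.∨-conicalʳ _ _ w∉))))
                  x∼u (gaining-false gu) (u≢w ∘ sym) renaming (impossible to impossible′)

      -- Two vertices of A with the same positive gain.

      module SameDegree {p q} (x∼p : x ∼ p) (x∼q : x ∼ q) (p≢q : p ≢ q)
        (dp≡dq : d p ≡ d q) (k<dp : k < d p) where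

        -- The path p w x q excludes any other neighbour in A. This confines N(p) to `q` and the k
        -- vertices off A, so degree above k forces all of them.
        only-neighbour : ∀ {w} → p ∼ w → x ∼ w → w ≡ q
        only-neighbour {w} p∼w x∼w = decidable-stable (w ≟ q) λ w≢q →
          separated (∼-sym p∼w) x∼w x∼p x∼q p≢q w≢q dp≡dq

        degree≡1+k : d p ≡ suc k
        degree≡1+k = ≤-antisym (≮⇒≥ too-large) k<dp
          where
          too-large : suc k < d p → ⊥
          too-large 1+k<dp with inner (q ∷ []) (subst (_< d p) (+-comm 1 k) 1+k<dp)
          ... | w , p∼w , x∼w , w≢q ∷ [] = w≢q (only-neighbour p∼w x∼w)

        adjacent : p ∼ q
        adjacent with inner [] (subst (_< d p) (sym (+-identityʳ k)) k<dp)
        ... | w , p∼w , x∼w , [] = subst (p ∼_) (only-neighbour p∼w x∼w) p∼w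

        complete-outside : ∀ {b} → x ≁ b → p ∼ b
        complete-outside {b} x≁b with pick (adj G p) (outside ∖ b) (q ∷ [])
          (subst₂ _<_ (trans (k≡1+ x≁b) (+-comm 1 _)) (d≡ p) k<dp)
        ... | w , p∼w , w∉ , w≢q ∷ [] = subst (p ∼_) (decidable-stable (w ≟ b) λ w≢b →
          w≢q (only-neighbour p∼w (outside-false
            (¬-not λ w-out → true≢false (∖-intro {P = outside} w-out w≢b) w∉)))) p∼w

      -- Only two vertices can repeat a positive gain: they form a component of G[A] and are
      -- adjacent to everything outside A, so paths through them separate the degrees of the others.
      module Repeated {v v′} (v≢v′ : v ≢ v′) (pos : 0 < gain v) (gain≡ : gain v ≡ gain v′) where

        x∼v : x ∼ v
        x∼v = proj₁ (gain-pos pos)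

        pos′ : 0 < gain v′
        pos′ = subst (0 <_) gain≡ pos

        x∼v′ : x ∼ v′
        x∼v′ = proj₁ (gain-pos pos′)

        k<d : ∀ {z} → 0 < gain z → k < d z
        k<d {z} gz = subst₂ _<_ (+-identityʳ k) (sym (proj₂ (gain-pos gz))) (+-monoʳ-< k gz)

        dv≡dv′ : d v ≡ d v′
        dv≡dv′ = gain≡⇒d≡ pos gain≡

        open SameDegree x∼v x∼v′ v≢v′ dv≡dv′ (k<d pos)
        open SameDegree x∼v′ x∼v (v≢v′ ∘ sym) (sym dv≡dv′) (k<d pos′)
          using () renaming (only-neighbour to only-neighbour′; complete-outside to complete-outside′)

        gain-v : gain v ≡ 1
        gain-v = trans (gain-in x∼v) (trans (cong (_∸ k) (trans degree≡1+k (+-comm 1 k))) (m+n∸m≡n k 1))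

        -- This and the next three facts rest on the paths v v′ x a, v x v′ b, a x v b and x v v′ b,
        -- in this order.
        inside≢1+k : ∀ {a} → x ∼ a → a ≢ v → a ≢ v′ → d a ≢ suc k
        inside≢1+k x∼a a≢v a≢v′ da≡ = separated (∼-sym adjacent) x∼v′ x∼v x∼a (a≢v ∘ sym) (a≢v′ ∘ sym)
          (trans degree≡1+k (sym da≡))

        outside≢1+k : ∀ {b} → x ≁ b → b ≢ x → d b ≢ suc k
        outside≢1+k x≁b b≢x db≡ = no-path (∼-sym x∼v) x∼v′ (complete-outside′ x≁b)
          (∼≁⇒≢ x∼v x≁b) v≢v′ (b≢x ∘ sym) (trans degree≡1+k (sym db≡))

        outside≢inside : ∀ {a b} → x ∼ a → a ≢ v → x ≁ b → b ≢ x → d a ≢ d b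
        outside≢inside x∼a a≢v x≁b b≢x = no-path (∼-sym x∼a) x∼v (complete-outside x≁b)
          (∼≁⇒≢ x∼a x≁b) a≢v (b≢x ∘ sym)

        outside≢Δ : ∀ {b} → x ≁ b → b ≢ x → d b ≢ d x
        outside≢Δ x≁b b≢x db≡ = no-path x∼v adjacent (complete-outside′ x≁b)
          (b≢x ∘ sym) (∼⇒≢ x∼v′) (∼≁⇒≢ x∼v x≁b) (sym db≡)

        -- Equal degrees above k + 1 would give `a` a neighbour z in A besides `b`, hence the path a
        -- z x b. Within A, degree k + 1 belongs to `v` and `v′` alone, and `v′` is erased.
        other-gain-injective : ∀ {a b} → 0 < erase v′ gain a → erase v′ gain a ≡ erase v′ gain b → a ≡ b
        other-gain-injective {a} {b} ga eq with a≢v′ , ga′ ← erase-positive v′ gain ga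
          | b≢v′ , gb′ ← erase-positive v′ gain (subst (0 <_) eq ga)
          = decidable-stable (a ≟ b) (distinct a≢v′ ga′ b≢v′ gb′
              (gain≡⇒d≡ ga′ (trans (sym (erase-other gain a≢v′)) (trans eq (erase-other gain b≢v′)))))
          where
          distinct : a ≢ v′ → 0 < gain a → b ≢ v′ → 0 < gain b → d a ≡ d b → a ≢ b → ⊥
          distinct a≢v′ ga b≢v′ gb da≡db a≢b
            with inner (b ∷ []) (subst (_< d a) (+-comm 1 k) (≤∧≢⇒< (k<d ga) (a≢1+k ∘ sym)))
            where
            a≢1+k : d a ≢ suc k
            a≢1+k da≡ = inside≢1+k (proj₁ (gain-pos ga)) a≢v a≢v′ da≡
              where
              a≢v : a ≢ v
              a≢v refl = inside≢1+k (proj₁ (gain-pos gb)) (a≢b ∘ sym) b≢v′ (trans (sym da≡db) da≡)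
          ... | z , a∼z , x∼z , z≢b ∷ [] =
            separated (∼-sym a∼z) x∼z (proj₁ (gain-pos ga)) (proj₁ (gain-pos gb)) a≢b z≢b da≡db

        -- The extra unit is the gain 1 of `v′`; the remaining positive gains are distinct.
        sum-gain≤ : ∀ b → (∀ v → gain v ≤ b) → sum gain ≤ suc (sumTo (λ j → j) b)
        sum-gain≤ b gain≤b = subst (_≤ suc (sumTo (λ j → j) b))
          (sym (trans (sum-erase v′ gain) (cong (_+ sum (erase v′ gain)) (trans (sym gain≡) gain-v))))
          (s≤s (sum-injective (λ j → j) refl (erase v′ gain) other-gain-injective b
            (λ u → ≤-trans (erase≤ v′ gain u) (gain≤b u))))

        s+loss≤2 : s + sum loss ≤ 2
        s+loss≤2 = cancel-≤ (s * s * 2 + s * 3) (≤-trans balance′ (sum-gain≤ top gain≤top))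
          (lhs s (sum loss)) (trans (cong (λ b → suc (top + b)) (sumTo-id s)) (rhs s))
          where
          lhs : ∀ s l → s * s * 2 + s * 4 + l ≡ s * s * 2 + s * 3 + (s + l)
          lhs = solve-∀
          rhs : ∀ s → suc (suc (s + s) + (s * (s + s) + s)) ≡ s * s * 2 + s * 3 + 2
          rhs = solve-∀

        no-top⇒s≡0 : (∀ a → gain a ≢ top) → s ≡ 0
        no-top⇒s≡0 no-top = s*3≤1⇒s≡0 s (m+n≤o⇒m≤o (s * 3)
          (cancel-≤ (s * s * 2 + s) (≤-trans balance′ (sum-gain≤ (s + s) (gain≤s+s no-top)))
            (lhs s (sum loss)) (trans (cong suc (sumTo-id s)) (rhs s))))
          where
          lhs : ∀ s l → s * s * 2 + s * 4 + l ≡ s * s * 2 + s + (s * 3 + l)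
          lhs = solve-∀
          rhs : ∀ s → suc (s * (s + s) + s) ≡ s * s * 2 + s + 1
          rhs = solve-∀
          s*3≤1⇒s≡0 : ∀ s → s * 3 ≤ 1 → s ≡ 0
          s*3≤1⇒s≡0 zero    _       = refl
          s*3≤1⇒s≡0 (suc s) (s≤s ())

        below-top : ∀ {b} → x ≁ b → b ≢ x → d b ≢ k + top → d b < k + top
        below-top {b} x≁b b≢x d≢ = ≤∧≢⇒<
          (s≤s⁻¹ (subst (d b <_) Δ≡ (≤∧≢⇒< (maximal b) (outside≢Δ x≁b b≢x)))) d≢

        loss≥2 : ∀ {b} → x ≁ b → d b < k + top → 2 ≤ loss b
        loss≥2 {b} x≁b d< = subst (2 ≤_) (sym (loss-out x≁b))
          (m+n≤o⇒m≤o∸n 2 (subst (2 + d b ≤_) (sym Δ≡) (s≤s d<)))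

        -- With s = 0, some further `a` in A and some `b` off A both have degree at most k. As `b`
        -- already loses 2, the bound on the total loss makes both degrees exactly k, against the
        -- path a x v b.
        s≢0 : s ≢ 0
        s≢0 s≡0 = by-choices (other-outside (s≡0⇒k≥2 s≡0))
          (pickOff (adj G x) (v ∷ v′ ∷ []) (subst (3 ≤_) (d≡ x) Δ≥3))
          where
          k+top≡ : k + top ≡ suc k
          k+top≡ = trans (cong (λ s → k + suc (s + s)) s≡0) (+-comm k 1)
          by-choices : ∃ (λ b → x ≁ b × b ≢ x) → ∃ (λ a → x ∼ a × All (a ≢_) (v ∷ v′ ∷ [])) → ⊥
          by-choices (b , x≁b , b≢x) (a , x∼a , a≢v ∷ a≢v′ ∷ []) = outside≢inside x∼a a≢v x≁b b≢x
            (trans (≤-antisym da≤k k≤da) (sym (≤-antisym (s≤s⁻¹ (subst (d b <_) k+top≡ db<)) k≤db)))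
            where
            db< : d b < k + top
            db< = below-top x≁b b≢x (λ db≡ → outside≢1+k x≁b b≢x (trans db≡ k+top≡))
            losses : loss a + (loss b + 0) ≤ 2
            losses = ≤-trans (sum-list≤ loss ((∼≁⇒≢ x∼a x≁b ∷ []) ∷ [] ∷ [])) (m+n≤o⇒n≤o s s+loss≤2)
            da≤k : d a ≤ k
            da≤k = s≤s⁻¹ (≤∧≢⇒< (subst (d a ≤_) k+top≡ (d≤ x∼a)) (inside≢1+k x∼a a≢v a≢v′))
            k≤da : k ≤ d a
            k≤da = m∸n≡0⇒m≤n (trans (sym (loss-in x∼a)) (n≤0⇒n≡0 (+-cancelʳ-≤ 2 _ _
              (≤-trans (+-monoʳ-≤ (loss a) (≤-trans (loss≥2 x≁b db<) (m≤m+n _ 0))) losses))))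
            k≤db : k ≤ d b
            k≤db = +-cancelʳ-≤ 2 k (d b) (begin
              k + 2                ≡⟨ +-comm k 2 ⟩
              suc (suc k)          ≡⟨ cong suc (sym k+top≡) ⟩
              suc (k + top)        ≡⟨ sym Δ≡ ⟩
              d x                  ≤⟨ m≤n+m∸n (d x) (d b) ⟩
              d b + (d x ∸ d b)    ≡⟨ cong (d b +_) (sym (loss-out x≁b)) ⟩
              d b + loss b         ≤⟨ +-monoʳ-≤ (d b) (m+n≤o⇒n≤o (loss a)
                                          (subst (λ l → loss a + l ≤ 2) (+-identityʳ _) losses)) ⟩
              d b + 2              ∎)
              where open ≤-Reasoning

        -- `a` would have degree Δ - 1 and miss itself, `v` and `v′`, which takes Δ + 2 vertices,
        -- while k ≤ 1 allows only Δ + 1.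
        k≤1⇒no-top : k ≤ 1 → ∀ {a} → gain a ≢ top
        k≤1⇒no-top k≤1 {a} ga≡ = <-irrefl refl (begin-strict
          d a + 2                              <⟨ +-monoʳ-< (d a) (n<1+n 2) ⟩
          d a + 3                              ≡⟨ cong (_+ 3) (d≡ a) ⟩
          count (adj G a) + 3                  ≤⟨ +-monoʳ-≤ (count (adj G a)) (m≤n+m 3 _) ⟩
          count (adj G a) + (count none + 3)   ≤⟨ count-disjoint (adj G a) none (λ _ ())
            ((a≢v ∷ a≢v′ ∷ []) ∷ (v≢v′ ∷ []) ∷ [] ∷ [])
            ((Graph.irrefl G a , refl) ∷ (a≁v , refl) ∷ (a≁v′ , refl) ∷ []) ⟩
          m                                    ≡⟨ m≡ ⟩
          k + d x                              ≤⟨ +-monoˡ-≤ (d x) k≤1 ⟩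
          1 + d x                              ≡⟨ cong suc (trans Δ≡ (cong suc (sym da≡))) ⟩
          2 + d a                              ≡⟨ +-comm 2 (d a) ⟩
          d a + 2                              ∎)
          where
          open ≤-Reasoning
          none : Fin m → Bool
          none _ = false
          a-pos : 0 < gain a
          a-pos = subst (0 <_) (sym ga≡) (s≤s z≤n)
          x∼a : x ∼ a
          x∼a = proj₁ (gain-pos a-pos)
          da≡ : d a ≡ k + top
          da≡ = trans (proj₂ (gain-pos a-pos)) (cong (k +_) ga≡)
          gain-a≢1 : gain a ≢ 1
          gain-a≢1 ga≡1 = s≢0 (m+n≡0⇒m≡0 s (suc-injective (trans (sym ga≡) ga≡1)))
          a≢v : a ≢ v
          a≢v refl = gain-a≢1 gain-v
          a≢v′ : a ≢ v′
          a≢v′ refl = gain-a≢1 (trans (sym gain≡) gain-v)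
          a≁v : a ≁ v
          a≁v = ¬-not λ a∼v → a≢v′ (only-neighbour (∼-sym a∼v) x∼a)
          a≁v′ : a ≁ v′
          a≁v′ = ¬-not λ a∼v′ → a≢v (only-neighbour′ (∼-sym a∼v′) x∼a)

        -- A second vertex `b` off A has neither degree Δ nor the degree Δ - 1 of `a`, so it loses
        -- at least 2, and `s+loss≤2` leaves s = 0.
        k≥2⇒no-top : 2 ≤ k → ∀ {a} → gain a ≢ top
        k≥2⇒no-top k≥2 {a} ga≡ = at (other-outside k≥2)
          where
          a-pos : 0 < gain a
          a-pos = subst (0 <_) (sym ga≡) (s≤s z≤n)
          a≢v : a ≢ v
          a≢v refl = s≢0 (m+n≡0⇒m≡0 s (suc-injective (trans (sym ga≡) gain-v)))
          at : ∃ (λ b → x ≁ b × b ≢ x) → ⊥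
          at (b , x≁b , b≢x) = s≢0 (n≤0⇒n≡0 (+-cancelʳ-≤ 2 s 0 (≤-trans
            (+-monoʳ-≤ s (≤-trans (loss≥2 x≁b (below-top x≁b b≢x λ db≡ →
              outside≢inside (proj₁ (gain-pos a-pos)) a≢v x≁b b≢x
                (trans (proj₂ (gain-pos a-pos)) (trans (cong (k +_) ga≡) (sym db≡)))))
              (term≤sum loss b)))
            s+loss≤2)))

        impossible : ⊥
        impossible = s≢0 (no-top⇒s≡0 λ a → no-top)
          where
          no-top : ∀ {a} → gain a ≢ top
          no-top with k ≤? 1
          ... | yes k≤1 = k≤1⇒no-top k≤1
          ... | no k≰1  = k≥2⇒no-top (≰⇒> k≰1)

      bipartite : s ≡ 0 × (∀ u v → adj G u v ≡ outside u xor outside v)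
      bipartite with any? (λ u → any? λ v → ¬? (u ≟ v) ×-dec (0 <? gain u) ×-dec (gain u ℕ.≟ gain v))
      ... | yes (u , v , u≢v , pos , gain≡) = ⊥-elim (Repeated.impossible u≢v pos gain≡)
      ... | no ∄ = from-top (any? λ v → gain v ℕ.≟ top)
        where
        open Distinct (λ {u} {v} pos eq → decidable-stable (u ≟ v) λ u≢v → ∄ (u , v , u≢v , pos , eq))
        from-top : Dec (∃ λ v → gain v ≡ top) → s ≡ 0 × (∀ u v → adj G u v ≡ outside u xor outside v)
        from-top (yes (v , gv)) = ⊥-elim (Top.impossible gv)
        from-top (no ∄top) = NoTop.s≡0 no-top , NoTop.bipartite no-top
          where
          no-top : ∀ v → gain v ≢ top
          no-top v gv = ∄top (v , gv)

  bipartite : t ≡ 1 × (∀ u v → adj G u v ≡ outside u xor outside v)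
  bipartite with any? (λ c → (adj G x c Bool.≟ true) ×-dec (d c ℕ.≟ d x))
  ... | yes (c , x∼c , dc≡) = ⊥-elim (from-private (any? λ u →
    (adj G x u Bool.≟ true) ×-dec ¬? (u ≟ c) ×-dec (adj G c u Bool.≟ false)))
    where
    open AdjacentMaxima x∼c dc≡
    from-private : Dec (∃ λ u → x ∼ u × u ≢ c × c ≁ u) → ⊥
    from-private (yes (u , x∼u , u≢c , c≁u)) = Private.impossible x∼u u≢c c≁u
    from-private (no ∄u) = Twins.impossible λ u x∼u u≢c → ¬-not λ c≁u → ∄u (u , x∼u , u≢c , c≁u)
  ... | no ∄c = by-t t refl
    where
    open InnerBelow (λ {c} x∼c dc≡ → ∄c (c , x∼c , dc≡))
    by-t : ∀ t′ → t ≡ t′ → t ≡ 1 × (∀ u v → adj G u v ≡ outside u xor outside v)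
    by-t zero    t≡ = contradiction t≡ t≢0
    by-t (suc s) t≡ with s≡0 , bip ← Positive.bipartite t≡ = trans t≡ (cong suc s≡0) , bip

-- Choosing x, k and t in a graph on 2n vertices.

theorem1p4 : (n : ℕ) → 3 ≤ n → (G : Graph (2 * n)) →
    n * n ∸ 1 ≤ edgeCount G →
    ¬ HasEqualDegreeP3 G →
    G ≅ K (n ∸ 1) (n + 1)
theorem1p4 n@(suc n′) 3≤n G edges no3 with argmax (degree G) zero
-- `outside` has k = n - 1 vertices; the other side has the remaining Δ = n + t = n + 1.
... | x , maximal = subst₂ (λ a b → G ≅ K a b)
  (trans count-outside k≡n∸1)
  (+-cancelˡ-≡ k _ _ (trans (cong (_+ count (not ∘ outside)) (sym count-outside))
    (trans (count-not outside) (trans 2n≡k+Δ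
      (cong (k +_) (trans (sym n+t≡Δ) (cong (n +_) (proj₁ bipartite))))))))
  (complete-bipartite G outside (proj₂ bipartite))
  where
  dense : n * n * 2 ≤ sum (degree G) + 2
  dense = begin
    n * n * 2                          ≤⟨ *-monoˡ-≤ 2 (≤-trans (m≤n+m∸n (n * n) 1) (+-monoʳ-≤ 1 edges)) ⟩
    (1 + edgeCount G) * 2              ≡⟨ double (edgeCount G) ⟩
    edgeCount G + edgeCount G + 2      ≡⟨ cong (_+ 2) (handshake G) ⟨
    sum (degree G) + 2                 ∎
    where
    open ≤-Reasoning
    double : ∀ e → (1 + e) * 2 ≡ e + e + 2
    double = solve-∀

  -- If Δ ≤ n - 1, the degree sum is at most 2n² - 2n, below the required 2n² - 2 because n ≥ 3.
  n≤Δ : n ≤ degree G x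
  n≤Δ = ≮⇒≥ λ Δ<n → <⇒≱ (≤-trans 3≤n (m≤m+n n (n + 0))) (+-cancelˡ-≤ (2 * n * degree G x) _ _ (begin
    2 * n * degree G x + 2 * n         ≡⟨ trans (+-comm _ (2 * n)) (sym (*-suc (2 * n) (degree G x))) ⟩
    2 * n * suc (degree G x)           ≤⟨ *-monoʳ-≤ (2 * n) Δ<n ⟩
    2 * n * n                          ≡⟨ trans (*-assoc 2 n n) (*-comm 2 (n * n)) ⟩
    n * n * 2                          ≤⟨ dense ⟩
    sum (degree G) + 2                 ≤⟨ +-monoˡ-≤ 2 (sum-mono maximal) ⟩
    sum {2 * n} (λ _ → degree G x) + 2 ≡⟨ cong (_+ 2) (sum-const (2 * n) (degree G x)) ⟩
    2 * n * degree G x + 2             ∎))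
    where open ≤-Reasoning

  -- `k` counts the non-neighbours of `x`, including `x` itself, so that 2n = k + Δ comes from a
  -- count; `n≤Δ` makes `t` an exact difference.
  t k : ℕ
  t = degree G x ∸ n
  k = count (λ v → not (adj G x v))

  n+t≡Δ : n + t ≡ degree G x
  n+t≡Δ = m+[n∸m]≡n n≤Δ

  2n≡k+Δ : 2 * n ≡ k + degree G x
  2n≡k+Δ = trans (sym (count-not (adj G x)))
    (trans (cong (_+ k) (sym (degree≡count G x))) (+-comm (degree G x) k))

  k+t≡n : k + t ≡ n
  k+t≡n = +-cancelˡ-≡ n _ _ (begin-equality
    n + (k + t)      ≡⟨ x∙yz≈y∙xz n k t ⟩
    k + (n + t)      ≡⟨ cong (k +_) n+t≡Δ ⟩
    k + degree G x   ≡⟨ 2n≡k+Δ ⟨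
    2 * n            ≡⟨ cong (n +_) (+-identityʳ n) ⟩
    n + n            ∎)
    where open ≤-Reasoning

  open Extremal G no3 x k t 2n≡k+Δ maximal
    (trans (sym n+t≡Δ) (trans (cong (_+ t) (sym k+t≡n)) (+-assoc k t t)))
    (subst (3 ≤_) (sym k+t≡n) 3≤n)
    (subst (λ n → n * n * 2 ≤ sum (degree G) + 2) (sym k+t≡n) dense)
    using (outside; count-outside; bipartite)

  k≡n∸1 : k ≡ n ∸ 1
  k≡n∸1 = trans (sym (m+n∸n≡m k 1)) (cong (_∸ 1) (trans (cong (k +_) (sym (proj₁ bipartite))) k+t≡n))
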